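{- Let $G$ be a finite simple graph that is $\{K_5-e, P_3\cup K_1\}$-free. Then $\chi(G)\le \omega(G)+1$.
   Context: $\chi(G)$ is the chromatic number and $\omega(G)$ the clique number. $K_5-e$ is the complete graph on five vertices with one edge removed. $P_3\cup K_1$ is the disjoint union of a path on three vertices and an isolated vertex. A graph is $\{H_1,\dots,H_k\}$-free if it has no induced subgraph isomorphic to any $H_i$. -}

module Defs where

open import Data.Nat using (ℕ; suc; _≤_)
open import Data.Fin using (Fin; zero; suc)
open import Data.Bool using (Bool; true; false)
open import Data.Product using (Σ; _×_; ∃)
open import Relation.Binary.PropositionalEquality using (_≡_; _≢_)
open import Relation.Nullary using (¬_)
open import Function.Definitions using (Injective)

record Graph (n : ℕ) : Set where
  field
    adj   : Fin n → Fin n → Bool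
    sym   : ∀ u v → adj u v ≡ adj v u
    irrefl : ∀ v → adj v v ≡ false
open Graph public

InducedSub : ∀ {m n} → Graph m → Graph n → Set
InducedSub {m} {n} H G =
  Σ (Fin m → Fin n) λ f → Injective _≡_ _≡_ f × (∀ u v → adj G (f u) (f v) ≡ adj H u v)

Free : ∀ {m n} → Graph m → Graph n → Set
Free H G = ¬ InducedSub H G

K5-e-adj : Fin 5 → Fin 5 → Bool
K5-e-adj zero zero = false
K5-e-adj zero (suc zero) = false
K5-e-adj (suc zero) zero = false
K5-e-adj (suc zero) (suc zero) = false
K5-e-adj zero (suc (suc _)) = true
K5-e-adj (suc zero) (suc (suc _)) = true
K5-e-adj (suc (suc _)) zero = true
K5-e-adj (suc (suc _)) (suc zero) = true
K5-e-adj (suc (suc i)) (suc (suc j)) = neq i j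
  where
  neq : ∀ {m} → Fin m → Fin m → Bool
  neq zero zero = false
  neq (suc a) (suc b) = neq a b
  neq zero (suc _) = true
  neq (suc _) zero = true

K5-e : Graph 5
K5-e = record { adj = K5-e-adj ; sym = s ; irrefl = i }
  where
  s : ∀ u v → K5-e-adj u v ≡ K5-e-adj v u
  s zero zero = _≡_.refl
  s zero (suc zero) = _≡_.refl
  s zero (suc (suc _)) = _≡_.refl
  s (suc zero) zero = _≡_.refl
  s (suc zero) (suc zero) = _≡_.refl
  s (suc zero) (suc (suc _)) = _≡_.refl
  s (suc (suc _)) zero = _≡_.refl
  s (suc (suc _)) (suc zero) = _≡_.refl
  s (suc (suc zero)) (suc (suc zero)) = _≡_.refl
  s (suc (suc zero)) (suc (suc (suc zero))) = _≡_.refl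
  s (suc (suc zero)) (suc (suc (suc (suc zero)))) = _≡_.refl
  s (suc (suc (suc zero))) (suc (suc zero)) = _≡_.refl
  s (suc (suc (suc zero))) (suc (suc (suc zero))) = _≡_.refl
  s (suc (suc (suc zero))) (suc (suc (suc (suc zero)))) = _≡_.refl
  s (suc (suc (suc (suc zero)))) (suc (suc zero)) = _≡_.refl
  s (suc (suc (suc (suc zero)))) (suc (suc (suc zero))) = _≡_.refl
  s (suc (suc (suc (suc zero)))) (suc (suc (suc (suc zero)))) = _≡_.refl
  i : ∀ v → K5-e-adj v v ≡ false
  i zero = _≡_.refl
  i (suc zero) = _≡_.refl
  i (suc (suc zero)) = _≡_.refl
  i (suc (suc (suc zero))) = _≡_.refl
  i (suc (suc (suc (suc zero)))) = _≡_.refl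

P3∪K1-adj : Fin 4 → Fin 4 → Bool
P3∪K1-adj zero (suc zero) = true
P3∪K1-adj (suc zero) zero = true
P3∪K1-adj (suc zero) (suc (suc zero)) = true
P3∪K1-adj (suc (suc zero)) (suc zero) = true
P3∪K1-adj _ _ = false

P3∪K1 : Graph 4
P3∪K1 = record { adj = P3∪K1-adj ; sym = s ; irrefl = i }
  where
  s : ∀ u v → P3∪K1-adj u v ≡ P3∪K1-adj v u
  s zero zero = _≡_.refl
  s zero (suc zero) = _≡_.refl
  s zero (suc (suc zero)) = _≡_.refl
  s zero (suc (suc (suc zero))) = _≡_.refl
  s (suc zero) zero = _≡_.refl
  s (suc zero) (suc zero) = _≡_.refl
  s (suc zero) (suc (suc zero)) = _≡_.refl
  s (suc zero) (suc (suc (suc zero))) = _≡_.refl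
  s (suc (suc zero)) zero = _≡_.refl
  s (suc (suc zero)) (suc zero) = _≡_.refl
  s (suc (suc zero)) (suc (suc zero)) = _≡_.refl
  s (suc (suc zero)) (suc (suc (suc zero))) = _≡_.refl
  s (suc (suc (suc zero))) zero = _≡_.refl
  s (suc (suc (suc zero))) (suc zero) = _≡_.refl
  s (suc (suc (suc zero))) (suc (suc zero)) = _≡_.refl
  s (suc (suc (suc zero))) (suc (suc (suc zero))) = _≡_.refl
  i : ∀ v → P3∪K1-adj v v ≡ false
  i zero = _≡_.refl
  i (suc zero) = _≡_.refl
  i (suc (suc zero)) = _≡_.refl
  i (suc (suc (suc zero))) = _≡_.refl

HasClique : ∀ {n} → Graph n → ℕ → Set
HasClique {n} G k =
  Σ (Fin k → Fin n) λ f → Injective _≡_ _≡_ f × (∀ i j → i ≢ j → adj G (f i) (f j) ≡ true)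

IsCliqueNumber : ∀ {n} → Graph n → ℕ → Set
IsCliqueNumber G w = HasClique G w × (∀ k → HasClique G k → k ≤ w)

Colourable : ∀ {n} → Graph n → ℕ → Set
Colourable {n} G k =
  Σ (Fin n → Fin k) λ c → ∀ u v → adj G u v ≡ true → c u ≢ c v

IsChromaticNumber : ∀ {n} → Graph n → ℕ → Set
IsChromaticNumber G x = Colourable G x × (∀ k → Colourable G k → x ≤ k)

{-# OPTIONS --safe #-}
module Submission where

-- If some a, b, c are pairwise non-adjacent, then, G being (P₃ ∪ K₁)-free, the vertices
-- non-adjacent to one of them induce a disjoint union of cliques, which is completely joined to the
-- rest of G; so induction on the number n of vertices applies.
--
-- Otherwise colour classes are vertices and edges of the complement. Let M be a maximum matching of
-- the complement and U the set of unmatched vertices. Each pair of M has an end adjacent in G to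
-- all of U, since there is no augmenting path. If these ends are pairwise adjacent, then together
-- with U they form a clique of size |M| + |U|. If two of them are not, then |U| ≤ 2 because G is
-- (K₅ − e)-free. For |U| ≤ 1 the bound |M| + |U| ≤ ω + 1 now follows from n ≤ 2ω + 2. For U = {x, y}
-- each end is non-adjacent to one of those two, and either all opposite ends are non-adjacent to
-- the same one of x, y and form a clique with the other, or the ends are few.
--
-- The inequality n ≤ 2ω + 2 holds because a vertex outside a maximum clique is adjacent to at most
-- two vertices of it: for ω ≥ 5 any two vertices outside are hence adjacent, and the cases ω ≤ 4
-- are Ramsey-type counts.

open import Defs
open import Data.Nat using (ℕ; zero; suc; _+_; _*_; _≤_; _<_; _≤?_; z≤n; s≤s; s≤s⁻¹)
open import Data.Nat.Properties using
  ( ≤-trans; ≤-reflexive; ≤-refl; ≰⇒>; 1+n≰n; m≤n+m; m≤m+n; m≤n⇒m≤1+n; module ≤-Reasoning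
  ; +-identityʳ; +-suc; +-comm; +-commutativeSemigroup; +-mono-≤; +-monoˡ-≤; +-monoʳ-≤; *-monoˡ-≤
  ; +-cancelˡ-≡; +-cancelˡ-≤; +-cancelʳ-≤; ⌊n/2⌋-mono; n≡⌊n+n/2⌋; n≡⌈n+n/2⌉ )
import Data.Nat as Nat
open import Algebra.Properties.CommutativeSemigroup +-commutativeSemigroup using (x∙yz≈y∙xz; interchange)
open import Data.Nat.ListAction using (sum)
open import Data.Fin using (Fin; zero; suc; toℕ; fromℕ<; _≟_)
open import Data.Fin.Properties using (toℕ-fromℕ<)
import Data.Bool as Bool
open import Data.Bool using (true; false)
open import Data.Product using (∃; _×_; _,_; proj₁; proj₂)
open import Data.Sum using (_⊎_; inj₁; inj₂; [_,_]′)
open import Data.Empty using (⊥; ⊥-elim)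
open import Data.List using (List; []; _∷_; _++_; length; map; filter; lookup; allFin)
open import Data.List.Properties using (length-++; length-map; filter-notAll; ++-assoc)
open import Data.List.Membership.Propositional using (_∈_; _∉_; find; lose)
open import Data.List.Membership.Propositional.Properties
  using (∈-∃++; ∈-++⁺ˡ; ∈-++⁺ʳ; ∈-++⁻; ∈-filter⁺; ∈-filter⁻; ∈-map⁺; ∈-map⁻; ∈-lookup; ∈-allFin)
open import Data.List.Relation.Binary.Subset.Propositional using (_⊆_)
open import Data.List.Relation.Binary.Subset.Propositional.Properties using (filter-⊆)
open import Data.List.Relation.Binary.Permutation.Propositional
  using (_↭_; refl; prep; swap; ↭-refl; ↭-sym; ↭-trans; ↭⇒↭ₛ; module PermutationReasoning)
open import Data.List.Relation.Binary.Permutation.Propositional.Properties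
  using (↭-length; ∈-resp-↭; All-resp-↭; shift; shifts; ++⁺ˡ; ++⁺ʳ)
import Data.List.Relation.Binary.Permutation.Setoid.Properties as PermutationSetoid
open import Data.List.Relation.Binary.Disjoint.Propositional using (Disjoint)
open import Data.List.Relation.Unary.Any using (here; there; any?)
open import Data.List.Relation.Unary.All as All using (All; []; _∷_)
import Data.List.Relation.Unary.All.Properties as All
open import Data.List.Relation.Unary.AllPairs using (AllPairs; []; _∷_)
open import Data.List.Relation.Unary.Unique.Propositional using (Unique)
import Data.List.Relation.Unary.Unique.Propositional.Properties as Unique
open import Function using (_∘_; id)
open import Relation.Binary.PropositionalEquality
  using (_≡_; _≢_; refl; trans; cong; subst; setoid; ≢-sym) renaming (sym to ≡-sym)
open import Relation.Nullary using (¬_; Dec; yes; no; contradiction)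
open import Relation.Nullary.Decidable using (¬?; _×-dec_; _⊎-dec_; decidable-stable; from-no)
open import Relation.Unary using (Pred; Decidable)

-- Duplicate-free lists, maximal elements and lists of pairs

module _ {A : Set} where

  unique-⊆-length : {xs ys : List A} → Unique xs → xs ⊆ ys → length xs ≤ length ys
  unique-⊆-length {[]} _ _ = z≤n
  unique-⊆-length {x ∷ xs} (x∉ ∷ u) sub with ∈-∃++ (sub (here refl))
  ... | ps , qs , refl =
    ≤-trans (s≤s (unique-⊆-length u rest)) (≤-reflexive (≡-sym (↭-length (shift x ps qs))))
    where
    rest : xs ⊆ ps ++ qs
    rest v∈ with ∈-resp-↭ (shift x ps qs) (sub (there v∈))
    ... | here refl = contradiction refl (All.lookup x∉ v∈)
    ... | there v∈′ = v∈′

  all⇒⊆ : {xs ys : List A} → All (_∈ ys) xs → xs ⊆ ys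
  all⇒⊆ = All.lookup

  unique-⊆-++-length : {xs : List A} (ys : List A) {zs : List A} →
    Unique xs → xs ⊆ ys ++ zs → length xs ≤ length ys + length zs
  unique-⊆-++-length ys u sub = ≤-trans (unique-⊆-length u sub) (≤-reflexive (length-++ ys))

  unique-++⁻ : (xs : List A) {ys : List A} → Unique (xs ++ ys) →
    Unique xs × Unique ys × Disjoint xs ys
  unique-++⁻ [] u = [] , u , λ ()
  unique-++⁻ (x ∷ xs) (x∉ ∷ u) with unique-++⁻ xs u
  ... | uxs , uys , dis = All.++⁻ˡ xs x∉ ∷ uxs , uys , λ where
    (here refl , v∈ys) → All.lookup (All.++⁻ʳ xs x∉) v∈ys refl
    (there v∈xs , v∈ys) → dis (v∈xs , v∈ys)

  unique-resp-↭ : {xs ys : List A} → xs ↭ ys → Unique xs → Unique ys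
  unique-resp-↭ p = PermutationSetoid.Unique-resp-↭ (setoid A) (↭⇒↭ₛ p)

  length≤2 : {xs : List A} → Unique xs →
    (∀ {x y z} → x ∈ xs → y ∈ xs → z ∈ xs → x ≢ y → x ≢ z → y ≢ z → ⊥) → length xs ≤ 2
  length≤2 {[]} _ _ = z≤n
  length≤2 {_ ∷ []} _ _ = s≤s z≤n
  length≤2 {_ ∷ _ ∷ []} _ _ = s≤s (s≤s z≤n)
  length≤2 {_ ∷ _ ∷ _ ∷ _} ((x≢y ∷ x≢z ∷ _) ∷ (y≢z ∷ _) ∷ _) f =
    ⊥-elim (f (here refl) (there (here refl)) (there (there (here refl))) x≢y x≢z y≢z)

  nonempty-↭ : {xs : List A} → 1 ≤ length xs → ∃ λ x → ∃ λ ys → xs ↭ x ∷ ys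
  nonempty-↭ {x ∷ xs} _ = x , xs , ↭-refl

  ∈-↭ : {x : A} {xs : List A} → x ∈ xs → ∃ λ ys → xs ↭ x ∷ ys
  ∈-↭ {x} x∈ with ∈-∃++ x∈
  ... | ps , qs , refl = ps ++ qs , shift x ps qs

  ∈∈-↭ : {x y : A} {xs : List A} → x ∈ xs → y ∈ xs → x ≢ y → ∃ λ ys → xs ↭ x ∷ y ∷ ys
  ∈∈-↭ {x} x∈ y∈ x≢y with ∈-↭ x∈
  ... | ys , p with ∈-resp-↭ p y∈
  ...   | here refl = contradiction refl x≢y
  ...   | there y∈′ with ∈-↭ y∈′
  ...     | zs , q = zs , ↭-trans p (prep x q)

  -- Without a maximum, `f` could be raised again and again, past `b`. For an arbitrary `P` it is
  -- undecidable whether a better element exists, hence the double negation; it disappears once the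
  -- goal is an inequality between numbers.
  ¬¬-∃-maximal : {P : A → Set} (f : A → ℕ) (b : ℕ) → (∀ {x} → P x → f x ≤ b) →
    ∀ {x₀} → P x₀ → ¬ ¬ ∃ λ x → P x × (∀ {y} → P y → f y ≤ f x)
  ¬¬-∃-maximal {P} f b f≤b {x₀} Px₀ ¬max = go b x₀ Px₀ (m≤n+m b (f x₀))
    where
    -- `fuel` bounds how far `f x` may still lie below `b`.
    go : ∀ fuel x → P x → b ≤ f x + fuel → ⊥
    go fuel x Px b≤ = ¬max (x , Px , λ {y} Py → decidable-stable (f y ≤? f x) (climb fuel b≤ Py))
      where
      climb : ∀ fuel → b ≤ f x + fuel → ∀ {y} → P y → ¬ ¬ (f y ≤ f x)
      climb zero b≤ Py fy≰fx =
        fy≰fx (≤-trans (f≤b Py) (≤-trans b≤ (≤-reflexive (+-identityʳ (f x)))))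
      climb (suc fuel) b≤ {y} Py fy≰fx =
        go fuel y Py (≤-trans b≤ (≤-trans (≤-reflexive (+-suc (f x) fuel))
                                          (+-monoˡ-≤ fuel (≰⇒> fy≰fx))))

  lookup-injective : {xs : List A} → Unique xs → ∀ {i j} → lookup xs i ≡ lookup xs j → i ≡ j
  lookup-injective (_ ∷ _) {zero} {zero} _ = refl
  lookup-injective (x∉ ∷ _) {zero} {suc j} eq = contradiction eq (All.lookup x∉ (∈-lookup j))
  lookup-injective (x∉ ∷ _) {suc i} {zero} eq = contradiction (≡-sym eq) (All.lookup x∉ (∈-lookup i))
  lookup-injective (_ ∷ u) {suc i} {suc j} eq = cong suc (lookup-injective u eq)

  pairUp : List (A × A) → List A
  pairUp [] = []
  pairUp ((a , b) ∷ M) = a ∷ b ∷ pairUp M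

  pairUp-++ : ∀ M {N} → pairUp (M ++ N) ≡ pairUp M ++ pairUp N
  pairUp-++ [] = refl
  pairUp-++ (_ ∷ M) = cong (λ xs → _ ∷ _ ∷ xs) (pairUp-++ M)

  pairUp-↭ : ∀ {M N} → M ↭ N → pairUp M ↭ pairUp N
  pairUp-↭ refl = refl
  pairUp-↭ (prep _ p) = prep _ (prep _ (pairUp-↭ p))
  pairUp-↭ (swap (a , b) (c , d) p) =
    ↭-trans (shifts (a ∷ b ∷ []) (c ∷ d ∷ [])) (++⁺ˡ (c ∷ d ∷ a ∷ b ∷ []) (pairUp-↭ p))
  pairUp-↭ (_↭_.trans p q) = ↭-trans (pairUp-↭ p) (pairUp-↭ q)

  pairUp-unzip : ∀ M → pairUp M ↭ map proj₁ M ++ map proj₂ M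
  pairUp-unzip [] = refl
  pairUp-unzip ((a , b) ∷ M) =
    prep a (↭-trans (prep b (pairUp-unzip M)) (↭-sym (shift b (map proj₁ M) (map proj₂ M))))

  length-pairUp : ∀ M → length (pairUp M) ≡ length M + length M
  length-pairUp [] = refl
  length-pairUp (_ ∷ M) =
    cong suc (trans (cong suc (length-pairUp M)) (≡-sym (+-suc (length M) (length M))))

-- Arithmetic and double counting

double-cancel-≤ : ∀ {m n} → m + m ≤ n + n → m ≤ n
double-cancel-≤ {m} {n} p =
  ≤-trans (≤-reflexive (n≡⌊n+n/2⌋ m)) (≤-trans (⌊n/2⌋-mono p) (≤-reflexive (≡-sym (n≡⌊n+n/2⌋ n))))

double-cancel-≤-suc : ∀ {m n} → m + m ≤ suc (n + n) → m ≤ n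
double-cancel-≤-suc {m} {n} p =
  ≤-trans (≤-reflexive (n≡⌊n+n/2⌋ m)) (≤-trans (⌊n/2⌋-mono p) (≤-reflexive (≡-sym (n≡⌈n+n/2⌉ n))))

module DoubleCounting {A B : Set} {R : A → B → Set} (R? : ∀ x y → Dec (R x y)) where

  row : List B → A → ℕ
  row ys x = length (filter (R? x) ys)

  column : List A → B → ℕ
  column xs y = length (filter (λ x → R? x y) xs)

  sum-row≡sum-column : ∀ xs ys → sum (map (row ys) xs) ≡ sum (map (column xs) ys)
  sum-row≡sum-column [] ys = ≡-sym (zeros ys)
    where
    zeros : ∀ ys → sum (map (column []) ys) ≡ 0
    zeros [] = refl
    zeros (_ ∷ ys) = zeros ys
  sum-row≡sum-column (x ∷ xs) ys =
    trans (cong (row ys x +_) (sum-row≡sum-column xs ys)) (add ys)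
    where
    add : ∀ ys → row ys x + sum (map (column xs) ys) ≡ sum (map (column (x ∷ xs)) ys)
    add [] = refl
    add (y ∷ ys) with R? x y
    ... | yes _ = cong suc (trans (x∙yz≈y∙xz (row ys x) (column xs y) _) (cong (column xs y +_) (add ys)))
    ... | no _ = trans (x∙yz≈y∙xz (row ys x) (column xs y) _) (cong (column xs y +_) (add ys))

  sum-lower : ∀ {C : Set} (f : C → ℕ) {q} xs → (∀ {x} → x ∈ xs → q ≤ f x) →
    length xs * q ≤ sum (map f xs)
  sum-lower f [] _ = z≤n
  sum-lower f (x ∷ xs) h = +-mono-≤ (h (here refl)) (sum-lower f xs (h ∘ there))

  sum-upper : ∀ {C : Set} (f : C → ℕ) {q} xs → (∀ {x} → x ∈ xs → f x ≤ q) →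
    sum (map f xs) ≤ length xs * q
  sum-upper f [] _ = z≤n
  sum-upper f (x ∷ xs) h = +-mono-≤ (h (here refl)) (sum-upper f xs (h ∘ there))

  -- Both sides estimate the number of related pairs, counted by rows and by columns.
  doubleCount : ∀ {xs ys p q} → (∀ {x} → x ∈ xs → q ≤ row ys x) →
    (∀ {y} → y ∈ ys → column xs y ≤ p) → length xs * q ≤ length ys * p
  doubleCount {xs} {ys} lower upper =
    ≤-trans (sum-lower (row ys) xs lower)
      (≤-trans (≤-reflexive (sum-row≡sum-column xs ys)) (sum-upper (column xs) ys upper))

-- Adjacency, gaps and cliques

module Complement {n} (G : Graph n) where

  infix 4 _~_ _#_ _~?_ _#?_

  V : Set
  V = Fin n

  -- A gap `u # v` is an edge of the complement graph.
  _~_ _#_ : V → V → Set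
  u ~ v = adj G u v ≡ true
  u # v = u ≢ v × adj G u v ≡ false

  _~?_ : ∀ u v → Dec (u ~ v)
  u ~? v = adj G u v Bool.≟ true

  _#?_ : ∀ u v → Dec (u # v)
  u #? v = ¬? (u ≟ v) ×-dec (adj G u v Bool.≟ false)

  ~-sym : ∀ {u v} → u ~ v → v ~ u
  ~-sym {u} {v} = trans (Graph.sym G v u)

  #-sym : ∀ {u v} → u # v → v # u
  #-sym {u} {v} (u≢v , p) = ≢-sym u≢v , trans (Graph.sym G v u) p

  ~-irrefl : ∀ {v} → ¬ v ~ v
  ~-irrefl {v} p with trans (≡-sym p) (irrefl G v)
  ... | ()

  ~⇒≢ : ∀ {u v} → u ~ v → u ≢ v
  ~⇒≢ u~v refl = ~-irrefl u~v

  ~⇒¬# : ∀ {u v} → u ~ v → ¬ u # v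
  ~⇒¬# p (_ , q) with trans (≡-sym p) q
  ... | ()

  ¬#⇒~ : ∀ {u v} → u ≢ v → ¬ u # v → u ~ v
  ¬#⇒~ {u} {v} u≢v ¬# with adj G u v in eq
  ... | true = refl
  ... | false = contradiction (u≢v , refl) ¬#

  data Position (u v : V) : Set where
    equal    : u ≡ v → Position u v
    adjacent : u ~ v → Position u v
    gap      : u # v → Position u v

  position : ∀ u v → Position u v
  position u v with u ≟ v | u #? v
  ... | yes p | _ = equal p
  ... | no _ | yes q = gap q
  ... | no p | no q = adjacent (¬#⇒~ p q)

  -- Encoded by the absence of gaps, so that a proof may assume a gap and refute it; `pairwise`
  -- recovers adjacency.
  record Clique (xs : List V) : Set where
    field
      unique : Unique xs
      noGap  : ∀ {u v} → u ∈ xs → v ∈ xs → ¬ u # v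

    pairwise : ∀ {u v} → u ∈ xs → v ∈ xs → u ≢ v → u ~ v
    pairwise u∈ v∈ u≢v = ¬#⇒~ u≢v (noGap u∈ v∈)

  open Clique public

  clique-[] : Clique []
  clique-[] = record { unique = [] ; noGap = λ () }

  clique-∷ : ∀ {x xs} → All (x ~_) xs → Clique xs → Clique (x ∷ xs)
  clique-∷ x~ c = record
    { unique = All.map ~⇒≢ x~ ∷ unique c
    ; noGap = λ where
        (here refl) (here refl) (p , _) → p refl
        (here refl) (there v∈) p → ~⇒¬# (All.lookup x~ v∈) p
        (there u∈) (here refl) p → ~⇒¬# (All.lookup x~ u∈) (#-sym p)
        (there u∈) (there v∈) p → noGap c u∈ v∈ p
    }

  clique-++ : ∀ {xs ys} → Clique xs → Clique ys →
    (∀ {u v} → u ∈ xs → v ∈ ys → u ~ v) → Clique (xs ++ ys)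
  clique-++ {xs} {ys} c d xs~ys = record
    { unique = Unique.++⁺ (unique c) (unique d) λ (p , q) → ~-irrefl (xs~ys p q)
    ; noGap = λ u∈ v∈ → sep (∈-++⁻ xs u∈) (∈-++⁻ xs v∈)
    }
    where
    sep : ∀ {u v} → u ∈ xs ⊎ u ∈ ys → v ∈ xs ⊎ v ∈ ys → ¬ u # v
    sep (inj₁ p) (inj₁ q) r = noGap c p q r
    sep (inj₁ p) (inj₂ q) r = ~⇒¬# (xs~ys p q) r
    sep (inj₂ p) (inj₁ q) r = ~⇒¬# (xs~ys q p) (#-sym r)
    sep (inj₂ p) (inj₂ q) r = noGap d p q r

  clique-⊆ : ∀ {xs ys} → Unique xs → xs ⊆ ys → Clique ys → Clique xs
  clique-⊆ u sub c = record { unique = u ; noGap = λ p q → noGap c (sub p) (sub q) }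

  K5-eFree : Set
  K5-eFree = ∀ {u v x y z} → u # v → x ~ y → x ~ z → y ~ z →
    u ~ x → u ~ y → u ~ z → v ~ x → v ~ y → v ~ z → ⊥

  P3∪K1Free : Set
  P3∪K1Free = ∀ {p q r s} → p ~ q → q ~ r → p # r → s # p → s # q → s # r → ⊥

  -- Independence number at most two: bounding the number of vertices by the clique number

  module Dense
    (K5-e-free : K5-eFree)
    {L : List V} (uL : Unique L)
    (α≤2 : ∀ {u v w} → u ∈ L → v ∈ L → w ∈ L → u # v → v # w → u # w → ⊥)
    {I : List V} (cI : Clique I) (I⊆L : I ⊆ L)
    (maximum : ∀ {Q} → Clique Q × Q ⊆ L → length Q ≤ length I)
    where

    ω : ℕ
    ω = length I

    -- A gap between two vertices of `xs` would form an independent triple with `u`.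
    common-#⇒clique : ∀ {u xs} → u ∈ L → Unique xs → xs ⊆ L →
      (∀ {v} → v ∈ xs → u # v) → Clique xs
    common-#⇒clique u∈ uxs xs⊆ u# = record
      { unique = uxs
      ; noGap = λ v∈ w∈ v#w → α≤2 u∈ (xs⊆ v∈) (xs⊆ w∈) (u# v∈) v#w (u# w∈)
      }

    common-#-length : ∀ {u xs} → u ∈ L → Unique xs → xs ⊆ L →
      (∀ {v} → v ∈ xs → u # v) → length xs ≤ ω
    common-#-length u∈ uxs xs⊆ u# = maximum (common-#⇒clique u∈ uxs xs⊆ u# , xs⊆)

    -- Three vertices of the clique would induce a K₅ - e together with `u` and `v`.
    common-~-length : ∀ {u v xs} → u # v → Clique xs →
      (∀ {w} → w ∈ xs → u ~ w × v ~ w) → length xs ≤ 2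
    common-~-length u#v c h = length≤2 (unique c) λ x∈ y∈ z∈ x≢y x≢z y≢z →
      K5-e-free u#v (pairwise c x∈ y∈ x≢y) (pairwise c x∈ z∈ x≢z) (pairwise c y∈ z∈ y≢z)
        (proj₁ (h x∈)) (proj₁ (h y∈)) (proj₁ (h z∈))
        (proj₂ (h x∈)) (proj₂ (h y∈)) (proj₂ (h z∈))

    filter-unique : ∀ {p} {P : Pred V p} (P? : Decidable P) → Unique (filter P? L)
    filter-unique P? = Unique.filter⁺ P? uL

    -- Stated for any maximum clique `K`, since `degree4` applies it to a clique other than `I`.
    module Outside {K} (cK : Clique K) (K⊆L : K ⊆ L) (ω≤K : ω ≤ length K) where

      -- By maximality `j` has a gap to some `i` in `K`, and the neighbours of `j` in `K` are then
      -- common neighbours of `i` and `j` inside a clique.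
      outside-~-length : ∀ {j} → j ∈ L → j ∉ K → length (filter (j ~?_) K) ≤ 2
      outside-~-length {j} j∈ j∉ with any? (j #?_) K
      ... | yes p with find p
      ...   | i , i∈ , j#i = common-~-length j#i
              (clique-⊆ (Unique.filter⁺ (j ~?_) (unique cK)) (filter-⊆ (j ~?_) K) cK)
              λ w∈ → let w∈K , j~w = ∈-filter⁻ (j ~?_) w∈ in
                j~w , pairwise cK i∈ w∈K λ { refl → ~⇒¬# j~w j#i }
      outside-~-length {j} j∈ j∉ | no p = contradiction
        (≤-trans (maximum (clique-∷ (All.tabulate j~) cK , λ { (here refl) → j∈ ; (there v∈) → K⊆L v∈ })) ω≤K)
        1+n≰n
        where
        j~ : ∀ {v} → v ∈ K → j ~ v
        j~ v∈ = ¬#⇒~ (λ { refl → j∉ v∈ }) λ j#v → p (lose v∈ j#v)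

      outside-#-length : ∀ {j} → j ∈ L → j ∉ K → length K ≤ length (filter (j #?_) K) + 2
      outside-#-length {j} j∈ j∉ =
        ≤-trans (unique-⊆-++-length (filter (j #?_) K) (unique cK) split)
                (+-monoʳ-≤ (length (filter (j #?_) K)) (outside-~-length j∈ j∉))
        where
        split : K ⊆ filter (j #?_) K ++ filter (j ~?_) K
        split {v} v∈ with position j v
        ... | equal refl = contradiction v∈ j∉
        ... | adjacent p = ∈-++⁺ʳ (filter (j #?_) K) (∈-filter⁺ (j ~?_) v∈ p)
        ... | gap p = ∈-++⁺ˡ (∈-filter⁺ (j #?_) v∈ p)

      _∈K? : ∀ v → Dec (v ∈ K)
      v ∈K? = any? (v ≟_) K

      outside : List V
      outside = filter (λ v → ¬? (v ∈K?)) L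

      outside⁻ : ∀ {v} → v ∈ outside → v ∈ L × v ∉ K
      outside⁻ = ∈-filter⁻ (λ v → ¬? (v ∈K?))

      outside⁺ : ∀ {v} → v ∈ L → v ∉ K → v ∈ outside
      outside⁺ = ∈-filter⁺ (λ v → ¬? (v ∈K?))

      length≤ω+outside : length L ≤ ω + length outside
      length≤ω+outside = ≤-trans (unique-⊆-++-length K uL split)
                                 (+-monoˡ-≤ (length outside) (maximum (cK , K⊆L)))
        where
        split : L ⊆ K ++ outside
        split {v} v∈ with v ∈K?
        ... | yes p = ∈-++⁺ˡ p
        ... | no p = ∈-++⁺ʳ K (outside⁺ v∈ p)

      -- Two vertices outside K are each adjacent to at most two vertices of K, so a gap
      -- between them would split K into two such sets.
      outside-gap : ∀ {j j′} → j ∈ outside → j′ ∈ outside → j # j′ →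
        ∀ {xs} → Unique xs → xs ⊆ K →
        length xs ≤ length (filter (j ~?_) xs) + length (filter (j′ ~?_) xs)
      outside-gap {j} {j′} j∈ j′∈ j#j′ {xs} uxs xs⊆ =
        unique-⊆-++-length (filter (j ~?_) xs) uxs split
        where
        split : xs ⊆ filter (j ~?_) xs ++ filter (j′ ~?_) xs
        split {v} v∈ with position j v | position j′ v
        ... | equal refl | _ = contradiction (xs⊆ v∈) (proj₂ (outside⁻ j∈))
        ... | adjacent p | _ = ∈-++⁺ˡ (∈-filter⁺ (j ~?_) v∈ p)
        ... | gap _ | equal refl = contradiction (xs⊆ v∈) (proj₂ (outside⁻ j′∈))
        ... | gap _ | adjacent q = ∈-++⁺ʳ (filter (j ~?_) xs) (∈-filter⁺ (j′ ~?_) v∈ q)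
        ... | gap p | gap q = ⊥-elim
          (α≤2 (proj₁ (outside⁻ j∈)) (proj₁ (outside⁻ j′∈)) (K⊆L (xs⊆ v∈)) j#j′ q p)

    module OutsideI = Outside cI I⊆L ≤-refl

    -- A gap outside `I` would cover `I` by two sets of at most two vertices each. So the vertices
    -- outside form a clique, again of size at most `ω`.
    length≤2ω : 5 ≤ ω → length L ≤ ω + ω
    length≤2ω 5≤ω = ≤-trans OutsideI.length≤ω+outside
      (+-monoʳ-≤ ω (maximum (record
        { unique = filter-unique _
        ; noGap = λ j∈ j′∈ j#j′ → from-no (5 ≤? 4)
            (≤-trans 5≤ω (≤-trans (OutsideI.outside-gap j∈ j′∈ j#j′ (unique cI) id)
              (+-mono-≤ (few j∈) (few j′∈))))
        } , filter-⊆ _ L)))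
      where
      few : ∀ {j} → j ∈ OutsideI.outside → length (filter (j ~?_) I) ≤ 2
      few j∈ = let j∈L , j∉I = OutsideI.outside⁻ j∈ in OutsideI.outside-~-length j∈L j∉I

    -- With more than 10 vertices, at least 7 lie outside `I`, each with at least 2 gaps into `I`.
    -- By `degree4` each of the 4 vertices of `I` receives at most 3 of these gaps, so 14 ≤ 12.
    length≤10 : ω ≡ 4 → length L ≤ 10
    length≤10 ω≡4 = decidable-stable (length L ≤? 10) λ L≰10 →
      let J = OutsideI.outside
          7≤J : 7 ≤ length J
          7≤J = +-cancelˡ-≤ 4 7 (length J) (≤-trans (≰⇒> L≰10)
                  (subst (λ w → length L ≤ w + length J) ω≡4 OutsideI.length≤ω+outside))
      in from-no (14 ≤? 12) (≤-trans (*-monoˡ-≤ 2 7≤J)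
           (subst (λ w → length J * 2 ≤ w * 3) ω≡4
             (DoubleCounting.doubleCount _#?_
               (λ j∈ → let j∈L , j∉I = OutsideI.outside⁻ j∈ in
                 +-cancelʳ-≤ 2 2 _ (≤-trans (≤-reflexive (≡-sym ω≡4))
                   (OutsideI.outside-#-length j∈L j∉I)))
               λ {i} i∈ → decidable-stable (_ ≤? 3) λ c≰3 →
                 L≰10 (degree4 (I⊆L i∈) (≤-trans (≰⇒> c≰3) (unique-⊆-length
                   (Unique.filter⁺ _ (filter-unique _))
                   λ v∈ → let v∈J , v#i = ∈-filter⁻ (_#? i) v∈ in
                     ∈-filter⁺ (i #?_) (proj₁ (OutsideI.outside⁻ v∈J)) (#-sym v#i)))))))
      where
      -- The non-neighbours of `u` form a maximum clique `K`. For `i` in `K`, the vertices outside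
      -- `K` split into the non-neighbours of `i`, a clique of at most 4 vertices, and the
      -- neighbours `S` of `i`, which number at most 2.
      degree4 : ∀ {u} → u ∈ L → 4 ≤ length (filter (u #?_) L) → length L ≤ 10
      degree4 {u} u∈ 4≤deg = ≤-trans length≤ω+outside
        (+-mono-≤ (≤-reflexive ω≡4) outside≤6)
        where
        K = filter (u #?_) L
        K⊆L = filter-⊆ (u #?_) L
        cK : Clique K
        cK = common-#⇒clique u∈ (filter-unique _) K⊆L λ v∈ → proj₂ (∈-filter⁻ (u #?_) {xs = L} v∈)
        ω≤K : ω ≤ length K
        ω≤K = ≤-trans (≤-reflexive ω≡4) 4≤deg
        open Outside cK K⊆L ω≤K
        J = outside
        uJ : Unique J
        uJ = filter-unique _
        decomposed = nonempty-↭ (≤-trans (s≤s z≤n) 4≤deg)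
        i = proj₁ decomposed
        K′ = proj₁ (proj₂ decomposed)
        K↭ = proj₂ (proj₂ decomposed)
        i∈K : i ∈ K
        i∈K = ∈-resp-↭ (↭-sym K↭) (here refl)
        u#i : u # i
        u#i = proj₂ (∈-filter⁻ (u #?_) {xs = L} i∈K)
        i∉uniq = unique-resp-↭ K↭ (unique cK)
        K′⊆K : K′ ⊆ K
        K′⊆K = ∈-resp-↭ (↭-sym K↭) ∘ there
        uK′ : Unique K′
        uK′ with i∉uniq
        ... | _ ∷ p = p
        i∉K′ : i ∉ K′
        i∉K′ i∈ with i∉uniq
        ... | p ∷ _ = All.lookup p i∈ refl
        S = filter (i ~?_) J
        -- One of the at most two neighbours of `j` in `K` is already `i`.
        few : ∀ {j} → j ∈ S → length (filter (j ~?_) K′) ≤ 1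
        few {j} j∈ = s≤s⁻¹ (≤-trans (unique-⊆-length
            (All.tabulate (λ v∈ → λ { refl → i∉K′ (filter-⊆ _ K′ v∈) }) ∷ Unique.filter⁺ _ uK′)
            λ { (here refl) → ∈-filter⁺ (j ~?_) i∈K (~-sym (proj₂ (∈-filter⁻ (i ~?_) {xs = J} j∈)))
              ; (there v∈) → let v∈K′ , p = ∈-filter⁻ (j ~?_) v∈ in
                  ∈-filter⁺ (j ~?_) (K′⊆K v∈K′) p })
          (let j∈L , j∉K = outside⁻ (filter-⊆ (i ~?_) J j∈) in
            outside-~-length j∈L j∉K))
        3≤K′ : 3 ≤ length K′
        3≤K′ = s≤s⁻¹ (≤-trans 4≤deg (≤-reflexive (↭-length K↭)))
        cS : Clique S
        cS = record
          { unique = Unique.filter⁺ _ uJ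
          ; noGap = λ j∈ j′∈ j#j′ → from-no (3 ≤? 2) (≤-trans 3≤K′
              (≤-trans (outside-gap (filter-⊆ _ J j∈) (filter-⊆ _ J j′∈) j#j′ uK′ K′⊆K)
                (+-mono-≤ (few j∈) (few j′∈))))
          }
        S≤2 : length S ≤ 2
        -- A vertex of `S` is adjacent to `u` as well as to `i`, because all non-neighbours of `u`
        -- lie in `K`.
        S≤2 = common-~-length u#i cS λ {w} w∈ →
          let w∈J , i~w = ∈-filter⁻ (i ~?_) w∈
              w∈L , w∉K = outside⁻ w∈J
          in ¬#⇒~ (λ { refl → ~⇒¬# i~w (#-sym u#i) })
                  (λ u#w → w∉K (∈-filter⁺ (u #?_) w∈L u#w))
           , i~w
        T≤4 : length (filter (i #?_) J) ≤ 4
        T≤4 = ≤-trans (common-#-length (K⊆L i∈K) (Unique.filter⁺ _ uJ)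
                (λ v∈ → filter-⊆ _ L (filter-⊆ (i #?_) J v∈))
                λ v∈ → proj₂ (∈-filter⁻ (i #?_) {xs = J} v∈)) (≤-reflexive ω≡4)
        outside≤6 : length J ≤ 6
        outside≤6 = ≤-trans (unique-⊆-++-length (filter (i #?_) J) uJ split) (+-mono-≤ T≤4 S≤2)
          where
          split : J ⊆ filter (i #?_) J ++ S
          split {v} v∈ with position i v
          ... | equal refl = contradiction i∈K (proj₂ (outside⁻ v∈))
          ... | adjacent p = ∈-++⁺ʳ (filter (i #?_) J) (∈-filter⁺ (i ~?_) v∈ p)
          ... | gap p = ∈-++⁺ˡ (∈-filter⁺ (i #?_) v∈ p)

    degree-split : ∀ {xs} → Unique xs → ∀ u →
      length xs ≤ suc (length (filter (u #?_) xs) + length (filter (u ~?_) xs))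
    degree-split {xs} uxs u = unique-⊆-++-length (u ∷ filter (u #?_) xs) uxs split
      where
      split : xs ⊆ u ∷ filter (u #?_) xs ++ filter (u ~?_) xs
      split {v} v∈ with position u v
      ... | equal refl = here refl
      ... | adjacent p = there (∈-++⁺ʳ (filter (u #?_) xs) (∈-filter⁺ (u ~?_) v∈ p))
      ... | gap p = there (∈-++⁺ˡ (∈-filter⁺ (u #?_) v∈ p))

    no-edge⇒length≤2 : ∀ {xs} → Unique xs → xs ⊆ L →
      (∀ {x y} → x ∈ xs → y ∈ xs → ¬ x ~ y) → length xs ≤ 2
    no-edge⇒length≤2 uxs xs⊆ h = length≤2 uxs λ x∈ y∈ z∈ x≢y x≢z y≢z →
      α≤2 (xs⊆ x∈) (xs⊆ y∈) (xs⊆ z∈)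
        (non-edge (h x∈ y∈) x≢y) (non-edge (h y∈ z∈) y≢z) (non-edge (h x∈ z∈) x≢z)
      where
      non-edge : ∀ {x y} → ¬ x ~ y → x ≢ y → x # y
      non-edge {x} {y} x≁y x≢y with position x y
      ... | equal p = contradiction p x≢y
      ... | adjacent p = contradiction p x≁y
      ... | gap p = p

    -- This is R(3,3) = 6: besides `u` there are at most two non-neighbours, which form a clique,
    -- and at most two neighbours, which span no edge.
    triangle-free⇒length≤5 : ∀ {xs} → Unique xs → xs ⊆ L →
      (∀ {Q} → Clique Q → Q ⊆ xs → length Q ≤ 2) → length xs ≤ 5
    triangle-free⇒length≤5 {[]} _ _ _ = z≤n
    triangle-free⇒length≤5 {u ∷ us} uxs xs⊆ small =
      ≤-trans (degree-split uxs u) (s≤s (+-mono-≤ non-neighbours neighbours))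
      where
      xs = u ∷ us
      non-neighbours : length (filter (u #?_) xs) ≤ 2
      non-neighbours = small
        (common-#⇒clique (xs⊆ (here refl)) (Unique.filter⁺ (u #?_) uxs) (xs⊆ ∘ filter-⊆ (u #?_) xs)
          λ v∈ → proj₂ (∈-filter⁻ (u #?_) {xs = xs} v∈))
        (filter-⊆ (u #?_) xs)
      neighbours : length (filter (u ~?_) xs) ≤ 2
      neighbours = no-edge⇒length≤2 (Unique.filter⁺ (u ~?_) uxs) (xs⊆ ∘ filter-⊆ (u ~?_) xs)
        λ x∈ y∈ x~y →
          let x∈xs , u~x = ∈-filter⁻ (u ~?_) {xs = xs} x∈
              y∈xs , u~y = ∈-filter⁻ (u ~?_) {xs = xs} y∈
          in from-no (3 ≤? 2) (small
               (clique-∷ (u~x ∷ u~y ∷ [])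
                 (clique-∷ (x~y ∷ []) (clique-∷ [] clique-[])))
               (all⇒⊆ (here refl ∷ x∈xs ∷ y∈xs ∷ [])))

    -- This is R(3,4) = 9. With at least 9 vertices, each vertex has exactly 3 non-neighbours and 5
    -- neighbours. The gaps between the non-neighbours `N u` and the neighbours `C u` are then
    -- counted twice: at least 3 · 2 from one side, at most 5 · 1 from the other.
    length≤8 : ω ≡ 3 → length L ≤ 8
    length≤8 ω≡3 = decidable-stable (length L ≤? 8) λ L≰8 →
      let u , _ , L↭ = nonempty-↭ (≤-trans (s≤s z≤n) (≰⇒> L≰8))
      in absurd (≰⇒> L≰8) (∈-resp-↭ (↭-sym L↭) (here refl))
      where
      max3 : ∀ {Q} → Clique Q → Q ⊆ L → length Q ≤ 3
      max3 c Q⊆ = ≤-trans (maximum (c , Q⊆)) (≤-reflexive ω≡3)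
      N C : V → List V
      N u = filter (u #?_) L
      C u = filter (u ~?_) L
      N⁻ : ∀ {u v} → v ∈ N u → v ∈ L × u # v
      N⁻ {u} = ∈-filter⁻ (u #?_)
      C⁻ : ∀ {u v} → v ∈ C u → v ∈ L × u ~ v
      C⁻ {u} = ∈-filter⁻ (u ~?_)
      common≤3 : ∀ {u xs} → u ∈ L → Unique xs → xs ⊆ L → (∀ {v} → v ∈ xs → u # v) → length xs ≤ 3
      common≤3 u∈ uxs xs⊆ u# = ≤-trans (common-#-length u∈ uxs xs⊆ u#) (≤-reflexive ω≡3)
      N≤3 : ∀ {u} → u ∈ L → length (N u) ≤ 3
      N≤3 u∈ = common≤3 u∈ (filter-unique _) (filter-⊆ _ L) (proj₂ ∘ N⁻)
      C≤5 : ∀ {u} → u ∈ L → length (C u) ≤ 5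
      C≤5 u∈ = triangle-free⇒length≤5 (filter-unique _) (filter-⊆ _ L) λ c Q⊆ →
        s≤s⁻¹ (max3 (clique-∷ (All.tabulate (proj₂ ∘ C⁻ ∘ Q⊆)) c)
                    λ { (here refl) → u∈ ; (there v∈) → filter-⊆ _ L (Q⊆ v∈) })

      absurd : 9 ≤ length L → ∀ {u} → u ∈ L → ⊥
      absurd 9≤L {u} u∈ = from-no (6 ≤? 5)
        (≤-trans (*-monoˡ-≤ 2 (3≤N u∈))
          (≤-trans (DoubleCounting.doubleCount _#?_ {N u} {C u} {1} {2} lower upper)
            (*-monoˡ-≤ 1 (C≤5 u∈))))
        where
        3≤N : ∀ {v} → v ∈ L → 3 ≤ length (N v)
        3≤N {v} v∈ = +-cancelʳ-≤ 5 3 _ (s≤s⁻¹ (≤-trans 9≤L (≤-trans (degree-split uL v)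
          (s≤s (+-monoʳ-≤ (length (N v)) (C≤5 v∈))))))
        5≤C : 5 ≤ length (C u)
        5≤C = +-cancelˡ-≤ 3 5 _ (s≤s⁻¹ (≤-trans 9≤L (≤-trans (degree-split uL u)
          (s≤s (+-monoˡ-≤ (length (C u)) (N≤3 u∈))))))
        -- Of the three gaps at `i` one goes to `u`, and none stays inside the clique `N u`.
        lower : ∀ {i} → i ∈ N u → 2 ≤ length (filter (i #?_) (C u))
        lower {i} i∈ = s≤s⁻¹ (≤-trans (3≤N i∈L) (unique-⊆-length (filter-unique _) split))
          where
          i∈L = proj₁ (N⁻ i∈)
          split : N i ⊆ u ∷ filter (i #?_) (C u)
          split {v} v∈ with position u v
          ... | equal refl = here refl
          ... | adjacent p = there (∈-filter⁺ (i #?_) (∈-filter⁺ (u ~?_) (proj₁ (N⁻ v∈)) p) (proj₂ (N⁻ v∈)))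
          ... | gap p = ⊥-elim (α≤2 u∈ i∈L (proj₁ (N⁻ v∈)) (proj₂ (N⁻ i∈)) (proj₂ (N⁻ v∈)) p)
        -- At most three gaps leave `c`, and at least two of them stay inside `C u`.
        upper : ∀ {c} → c ∈ C u → length (filter (_#? c) (N u)) ≤ 1
        upper {c} c∈ = +-cancelʳ-≤ 2 _ 1 (≤-trans (+-monoʳ-≤ (length X) 2≤Y)
          (≤-trans (≤-reflexive (≡-sym (length-++ X))) (common≤3 c∈L
            (Unique.++⁺ (Unique.filter⁺ _ (filter-unique _)) (Unique.filter⁺ _ (filter-unique _))
              λ (p , q) → ~⇒¬# (proj₂ (C⁻ (filter-⊆ _ (C u) q))) (proj₂ (N⁻ (filter-⊆ _ (N u) p))))
            (λ v∈ → [ filter-⊆ _ L ∘ filter-⊆ _ (N u) , filter-⊆ _ L ∘ filter-⊆ _ (C u) ]′ (∈-++⁻ X v∈))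
            λ v∈ → [ (λ p → #-sym (proj₂ (∈-filter⁻ (_#? c) {xs = N u} p)))
                   , (λ p → proj₂ (∈-filter⁻ (c #?_) {xs = C u} p)) ]′ (∈-++⁻ X v∈))))
          where
          c∈L = proj₁ (C⁻ c∈)
          u~c = proj₂ (C⁻ c∈)
          X = filter (_#? c) (N u)
          Y = filter (c #?_) (C u)
          -- Among the other four vertices of `C u`, at most two are neighbours of `c`: an edge
          -- between two such neighbours would give a 4-clique with `u` and `c`.
          2≤Y : 2 ≤ length Y
          2≤Y = +-cancelʳ-≤ 2 2 _ (s≤s⁻¹ (≤-trans 5≤C (≤-trans (degree-split (filter-unique _) c)
            (s≤s (+-monoʳ-≤ (length Y)
              (no-edge⇒length≤2 (Unique.filter⁺ _ (filter-unique _))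
                (filter-⊆ _ L ∘ filter-⊆ (c ~?_) (C u)) λ x∈ y∈ x~y →
                let x∈C , c~x = ∈-filter⁻ (c ~?_) x∈
                    y∈C , c~y = ∈-filter⁻ (c ~?_) y∈
                    x∈L , u~x = C⁻ x∈C
                    y∈L , u~y = C⁻ y∈C
                in from-no (4 ≤? 3) (max3
                     (clique-∷ (u~c ∷ u~x ∷ u~y ∷ [])
                       (clique-∷ (c~x ∷ c~y ∷ [])
                         (clique-∷ (x~y ∷ []) (clique-∷ [] clique-[]))))
                     (all⇒⊆ (u∈ ∷ c∈L ∷ x∈L ∷ y∈L ∷ [])))))))))

    length≤2ω+2 : length L ≤ 2 + (ω + ω)
    length≤2ω+2 = go ω refl
      where
      -- `ω` is the length of a list, so the cases are distinguished on a number equal to it.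
      go : ∀ w → ω ≡ w → length L ≤ 2 + (w + w)
      tiny : ∀ {w} → ω ≡ w → w ≤ 1 → length L ≤ 2
      tiny ω≡w w≤1 = no-edge⇒length≤2 uL id λ x∈ y∈ x~y → from-no (2 ≤? 1)
        (≤-trans (maximum ( clique-∷ (x~y ∷ []) (clique-∷ [] clique-[])
                          , all⇒⊆ (x∈ ∷ y∈ ∷ [])))
                 (≤-trans (≤-reflexive ω≡w) w≤1))
      go 0 ω≡ = tiny ω≡ z≤n
      go 1 ω≡ = ≤-trans (tiny ω≡ (s≤s z≤n)) (m≤m+n 2 2)
      go 2 ω≡ = ≤-trans (triangle-free⇒length≤5 uL id λ c Q⊆ →
                           ≤-trans (maximum (c , Q⊆)) (≤-reflexive ω≡)) (m≤m+n 5 1)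
      go 3 ω≡ = length≤8 ω≡
      go 4 ω≡ = length≤10 ω≡
      go w@(suc (suc (suc (suc (suc _))))) ω≡ =
        ≤-trans (length≤2ω (≤-trans (s≤s (s≤s (s≤s (s≤s (s≤s z≤n))))) (≤-reflexive (≡-sym ω≡))))
          (≤-trans (≤-reflexive (cong (λ k → k + k) ω≡)) (m≤n+m (w + w) 2))

    -- Maximum matchings of the complement

    record Matching (M : List (V × V)) (U : List V) : Set where
      field
        -- As `L` is duplicate-free, this makes the pairs and `U` disjoint, and they exhaust `L`.
        perm : pairUp M ++ U ↭ L
        gaps : All (λ (a , b) → a # b) M

    open Matching

    length-L : ∀ {M U} → Matching M U → length L ≡ (length M + length M) + length U
    length-L {M} {U} m = trans (≡-sym (↭-length (perm m)))
      (trans (length-++ (pairUp M)) (cong (_+ length U) (length-pairUp M)))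

    module MinimalMatching {M U} (matching : Matching M U)
      (minimal : ∀ {M′ U′} → Matching M′ U′ → length U ≤ length U′) where

      -- `P` and `P′` are the alternate edges of an augmenting path from `x` to `y`; exchanging them
      -- would leave two unmatched vertices fewer.
      no-augmentation : ∀ P P′ {M′ x y U′} → M ↭ P ++ M′ → U ↭ x ∷ y ∷ U′ →
        pairUp P′ ↭ pairUp P ++ x ∷ y ∷ [] → All (λ (a , b) → a # b) P′ → ⊥
      no-augmentation P P′ {M′} {x} {y} {U′} M↭ U↭ P′↭ gapsP′ =
        1+n≰n (≤-trans (≤-trans (≤-reflexive (≡-sym (↭-length U↭))) (minimal augmented)) (m≤n+m _ 1))
        where
        open PermutationReasoning
        xy = x ∷ y ∷ []
        augmented : Matching (P′ ++ M′) U′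
        augmented = record
          { gaps = All.++⁺ gapsP′ (All.++⁻ʳ P (All-resp-↭ M↭ (gaps matching)))
          ; perm = begin
              pairUp (P′ ++ M′) ++ U′             ≡⟨ cong (_++ U′) (pairUp-++ P′) ⟩
              (pairUp P′ ++ pairUp M′) ++ U′      ≡⟨ ++-assoc (pairUp P′) _ _ ⟩
              pairUp P′ ++ pairUp M′ ++ U′        ↭⟨ ++⁺ʳ _ P′↭ ⟩
              (pairUp P ++ xy) ++ pairUp M′ ++ U′ ≡⟨ ++-assoc (pairUp P) _ _ ⟩
              pairUp P ++ xy ++ pairUp M′ ++ U′   ↭⟨ ++⁺ˡ (pairUp P) (shifts xy (pairUp M′)) ⟩
              pairUp P ++ pairUp M′ ++ xy ++ U′   ≡⟨ ++-assoc (pairUp P) _ _ ⟨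
              (pairUp P ++ pairUp M′) ++ xy ++ U′ ≡⟨ cong (_++ xy ++ U′) (pairUp-++ P) ⟨
              pairUp (P ++ M′) ++ xy ++ U′        ↭⟨ ++⁺ʳ _ (pairUp-↭ M↭) ⟨
              pairUp M ++ xy ++ U′                ↭⟨ ++⁺ˡ (pairUp M) U↭ ⟨
              pairUp M ++ U                       ↭⟨ perm matching ⟩
              L                                   ∎
          }

      U⊆L : U ⊆ L
      U⊆L x∈ = ∈-resp-↭ (perm matching) (∈-++⁺ʳ (pairUp M) x∈)

      -- A gap inside `U` is an augmenting path of length one.
      cliqueU : Clique U
      cliqueU = record
        { unique = proj₁ (proj₂ (unique-++⁻ (pairUp M) (unique-resp-↭ (↭-sym (perm matching)) uL)))
        ; noGap = λ x∈ y∈ x#y → let _ , U↭ = ∈∈-↭ x∈ y∈ (proj₁ x#y) in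
            no-augmentation [] ((_ , _) ∷ []) ↭-refl U↭ ↭-refl (x#y ∷ [])
        }

      Unattached : V → Set
      Unattached v = ∀ {x} → x ∈ U → ¬ v # x

      -- If `a # x` and `b # y`, then either `x` equals `y` and completes an independent triple, or
      -- x a b y is an augmenting path.
      free-end : ∀ {a b} → (a , b) ∈ M → Unattached a ⊎ Unattached b
      free-end {a} {b} ab∈ with any? (a #?_) U | any? (b #?_) U
      ... | no p | _ = inj₁ λ x∈ q → p (lose x∈ q)
      ... | yes _ | no p = inj₂ λ x∈ q → p (lose x∈ q)
      ... | yes p | yes q with find p | find q
      ...   | x , x∈ , a#x | y , y∈ , b#y with x ≟ y
      ...     | yes refl = ⊥-elim (α≤2 a∈L b∈L (U⊆L x∈) (All.lookup (gaps matching) ab∈) b#y a#x)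
        where
        a∈L : a ∈ L
        a∈L = ∈-resp-↭ (perm matching) (∈-++⁺ˡ
          (∈-resp-↭ (↭-sym (pairUp-unzip M)) (∈-++⁺ˡ (∈-map⁺ proj₁ ab∈))))
        b∈L : b ∈ L
        b∈L = ∈-resp-↭ (perm matching) (∈-++⁺ˡ
          (∈-resp-↭ (↭-sym (pairUp-unzip M)) (∈-++⁺ʳ (map proj₁ M) (∈-map⁺ proj₂ ab∈))))
      ...     | no x≢y = let _ , M↭ = ∈-↭ ab∈ ; _ , U↭ = ∈∈-↭ x∈ y∈ x≢y in ⊥-elim
        (no-augmentation ((a , b) ∷ []) ((a , x) ∷ (b , y) ∷ []) M↭ U↭
          (prep a (swap x b ↭-refl)) (a#x ∷ b#y ∷ []))

      -- Pairs are reversed where necessary, so that the end adjacent to all of `U` comes second.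
      orient : ∀ N → (∀ {a b} → (a , b) ∈ N → Unattached a ⊎ Unattached b) → All (λ (a , b) → a # b) N →
        ∃ λ N′ → pairUp N′ ↭ pairUp N × length N′ ≡ length N × All (λ (a , b) → a # b) N′ ×
                 (∀ {a b} → (a , b) ∈ N′ → Unattached b)
      orient [] _ _ = [] , ↭-refl , refl , [] , λ ()
      orient ((a , b) ∷ N) ends (a#b ∷ gapsN) with orient N (ends ∘ there) gapsN | ends (here refl)
      ... | N′ , N′↭ , len , gapsN′ , freeN′ | inj₁ free-a =
        (b , a) ∷ N′ , swap b a N′↭ , cong suc len , #-sym a#b ∷ gapsN′ , λ where
          (here refl) → free-a
          (there p) → freeN′ p
      ... | N′ , N′↭ , len , gapsN′ , freeN′ | inj₂ free-b =
        (a , b) ∷ N′ , prep a (prep b N′↭) , cong suc len , a#b ∷ gapsN′ , λ where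
          (here refl) → free-b
          (there p) → freeN′ p

    module OrientedMatching {M U} (matching : Matching M U)
      (minimal : ∀ {M′ U′} → Matching M′ U′ → length U ≤ length U′)
      (free : ∀ {a b} → (a , b) ∈ M → ∀ {x} → x ∈ U → ¬ b # x) where

      open MinimalMatching matching minimal using (no-augmentation; U⊆L; cliqueU; Unattached)

      A B : List V
      A = map proj₁ M
      B = map proj₂ M

      ABU↭L : (A ++ B) ++ U ↭ L
      ABU↭L = ↭-trans (↭-sym (++⁺ʳ U (pairUp-unzip M))) (perm matching)

      A⊆L : A ⊆ L
      A⊆L v∈ = ∈-resp-↭ ABU↭L (∈-++⁺ˡ (∈-++⁺ˡ v∈))

      B⊆L : B ⊆ L
      B⊆L v∈ = ∈-resp-↭ ABU↭L (∈-++⁺ˡ (∈-++⁺ʳ A v∈))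

      unique-AB×disjoint : Unique (A ++ B) × Unique U × Disjoint (A ++ B) U
      unique-AB×disjoint = unique-++⁻ (A ++ B) (unique-resp-↭ (↭-sym ABU↭L) uL)

      unique-A×B×disjoint : Unique A × Unique B × Disjoint A B
      unique-A×B×disjoint = unique-++⁻ A (proj₁ unique-AB×disjoint)

      uA = proj₁ unique-A×B×disjoint
      uB = proj₁ (proj₂ unique-A×B×disjoint)

      A≢U : ∀ {a x} → a ∈ A → x ∈ U → a ≢ x
      A≢U a∈ x∈ refl = proj₂ (proj₂ unique-AB×disjoint) (∈-++⁺ˡ a∈ , x∈)

      B≢U : ∀ {b x} → b ∈ B → x ∈ U → b ≢ x
      B≢U b∈ x∈ refl = proj₂ (proj₂ unique-AB×disjoint) (∈-++⁺ʳ A b∈ , x∈)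

      B-free : ∀ {b} → b ∈ B → Unattached b
      B-free b∈ with ∈-map⁻ proj₂ b∈
      ... | _ , ab∈ , refl = free ab∈

      B~U : ∀ {b x} → b ∈ B → x ∈ U → b ~ x
      B~U b∈ x∈ = ¬#⇒~ (B≢U b∈ x∈) (B-free b∈ x∈)

      length-B++U : length (B ++ U) ≡ length M + length U
      length-B++U = trans (length-++ B) (cong (_+ length U) (length-map proj₂ M))

      -- Otherwise x a b d c y would be an augmenting path.
      gap-ends : ∀ {a b c d x y} → x ∈ U → y ∈ U → x ≢ y → (a , b) ∈ M → (c , d) ∈ M →
        b # d → a # x → ¬ c # y
      gap-ends {a} {b} {c} {d} {x} {y} x∈ y∈ x≢y ab∈ cd∈ b#d a#x c#y =
        let _ , M↭ = ∈∈-↭ ab∈ cd∈ λ { refl → proj₁ b#d refl }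
            _ , U↭ = ∈∈-↭ x∈ y∈ x≢y
        in no-augmentation ((a , b) ∷ (c , d) ∷ []) ((a , x) ∷ (b , d) ∷ (c , y) ∷ []) M↭ U↭
             (prep a (begin
               x ∷ b ∷ d ∷ c ∷ y ∷ [] ↭⟨ shift x (b ∷ d ∷ c ∷ []) (y ∷ []) ⟨
               b ∷ d ∷ c ∷ x ∷ y ∷ [] ↭⟨ prep b (swap d c ↭-refl) ⟩
               b ∷ c ∷ d ∷ x ∷ y ∷ [] ∎))
             (a#x ∷ b#d ∷ c#y ∷ [])
        where open PermutationReasoning

      module TwoUnmatched {x y} (x∈ : x ∈ U) (y∈ : y ∈ U) (x≢y : x ≢ y)
        {a b a′ b′} (ab∈ : (a , b) ∈ M) (ab∈′ : (a′ , b′) ∈ M) (b#b′ : b # b′) where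

        b∈ : b ∈ B
        b∈ = ∈-map⁺ proj₂ ab∈

        b∈′ : b′ ∈ B
        b∈′ = ∈-map⁺ proj₂ ab∈′

        -- Otherwise the triangle on `x`, `y`, `v` would be joined to both ends of the gap `b # b′`,
        -- giving a K₅ - e.
        gap-dominates : ∀ {v} → v ~ x → v ~ y → b # v ⊎ b′ # v
        gap-dominates {v} v~x v~y with position b v | position b′ v
        ... | gap p | _ = inj₁ p
        ... | _ | gap p = inj₂ p
        ... | equal refl | _ = inj₂ (#-sym b#b′)
        ... | _ | equal refl = inj₁ b#b′
        ... | adjacent p | adjacent q = ⊥-elim (K5-e-free b#b′
          (pairwise cliqueU x∈ y∈ x≢y) (~-sym v~x) (~-sym v~y)
          (B~U b∈ x∈) (B~U b∈ y∈) p (B~U b∈′ x∈) (B~U b∈′ y∈) q)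

        -- All first ends turn out to be non-adjacent to `x` and adjacent to `y`. As common
        -- non-neighbours of `x` they form a clique, which `y` extends.
        all-ends-hit : (∀ {a} → a ∈ A → a # x ⊎ a # y) → a # x → suc (length M) ≤ ω
        all-ends-hit hit a#x = ≤-trans
          (≤-reflexive (cong suc (≡-sym (length-map proj₁ M))))
          (maximum ( clique-∷ (All.tabulate y~)
                       (common-#⇒clique (U⊆L x∈) uA A⊆L (#-sym ∘ proj₁ ∘ only-x))
                   , λ { (here refl) → U⊆L y∈ ; (there c∈) → A⊆L c∈ }))
          where
          -- Since `d` has a gap to `b` or `b′`, a gap `c # y` would close an augmenting path that
          -- starts at `x` and runs through the pair of `b` or of `b′`.
          missed : ∀ {c d} → (c , d) ∈ M → ¬ c # y
          missed cd∈ with gap-dominates (B~U (∈-map⁺ proj₂ cd∈) x∈) (B~U (∈-map⁺ proj₂ cd∈) y∈)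
          ... | inj₁ b#d = gap-ends x∈ y∈ x≢y ab∈ cd∈ b#d a#x
          ... | inj₂ b′#d with hit (∈-map⁺ proj₁ ab∈′)
          ...   | inj₁ a′#x = gap-ends x∈ y∈ x≢y ab∈′ cd∈ b′#d a′#x
          ...   | inj₂ a′#y = contradiction a′#y (gap-ends x∈ y∈ x≢y ab∈ ab∈′ b#b′ a#x)
          only-x : ∀ {c} → c ∈ A → c # x × ¬ c # y
          only-x c∈ with ∈-map⁻ proj₁ c∈
          ... | _ , cd∈ , refl with hit c∈
          ...   | inj₁ c#x = c#x , missed cd∈
          ...   | inj₂ c#y = contradiction c#y (missed cd∈)
          y~ : ∀ {c} → c ∈ A → y ~ c
          y~ c∈ = ~-sym (¬#⇒~ (A≢U c∈ y∈) (proj₂ (only-x c∈)))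

        -- For `ω ≥ 5` the bound 2ω on the vertex count suffices. For `ω ≤ 4`, the vertices of
        -- `c ∷ B` are all adjacent to `x` and `y`, and each has a gap to `b` or `b′`. So they fall
        -- into two cliques, each of which `x` and `y` extend.
        end-missed : length U ≡ 2 → ∀ {c} → c ∈ A → c ~ x → c ~ y → suc (length M) ≤ ω
        end-missed U≡2 {c} c∈ c~x c~y with ω ≤? 4
        ... | no ω≰4 = double-cancel-≤ (≤-trans
          (≤-reflexive (trans (cong suc (+-suc (length M) (length M)))
            (trans (+-comm 2 (length M + length M))
              (trans (cong (length M + length M +_) (≡-sym U≡2)) (≡-sym (length-L matching))))))
          (length≤2ω (≰⇒> ω≰4)))
        -- The two cliques give |M| + 1 ≤ 2(ω - 2), which is at most ω here; adding 4 avoids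
        -- subtraction.
        ... | yes ω≤4 = +-cancelʳ-≤ 4 _ _ (begin
          suc (length M) + 4                ≡⟨ cong (λ k → suc k + 4) (length-map proj₂ M) ⟨
          length B′ + 4                     ≤⟨ +-monoˡ-≤ 4 (unique-⊆-++-length X uB′ split) ⟩
          (length X + length Y) + (2 + 2)   ≡⟨ interchange (length X) (length Y) 2 2 ⟩
          (length X + 2) + (length Y + 2)   ≤⟨ +-mono-≤ (small b∈) (small b∈′) ⟩
          ω + ω                             ≤⟨ +-monoʳ-≤ ω ω≤4 ⟩
          ω + 4                             ∎)
          where
          open ≤-Reasoning
          B′ = c ∷ B
          X = filter (b #?_) B′
          Y = filter (b′ #?_) B′
          uB′ : Unique B′
          uB′ = All.tabulate (λ { d∈ refl → proj₂ (proj₂ unique-A×B×disjoint) (c∈ , d∈) }) ∷ uB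
          B′⊆L : B′ ⊆ L
          B′⊆L (here refl) = A⊆L c∈
          B′⊆L (there d∈) = B⊆L d∈
          B′~ : ∀ {v} → v ∈ B′ → v ~ x × v ~ y
          B′~ (here refl) = c~x , c~y
          B′~ (there d∈) = B~U d∈ x∈ , B~U d∈ y∈
          split : B′ ⊆ X ++ Y
          split v∈ with gap-dominates (proj₁ (B′~ v∈)) (proj₂ (B′~ v∈))
          ... | inj₁ p = ∈-++⁺ˡ (∈-filter⁺ (b #?_) v∈ p)
          ... | inj₂ p = ∈-++⁺ʳ X (∈-filter⁺ (b′ #?_) v∈ p)
          small : ∀ {b} → b ∈ B → length (filter (b #?_) B′) + 2 ≤ ω
          small {b} b∈ = ≤-trans (≤-reflexive (≡-sym (length-++ Z))) (maximum
            ( clique-++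
                (common-#⇒clique (B⊆L b∈) (Unique.filter⁺ (b #?_) uB′) (B′⊆L ∘ filter-⊆ (b #?_) B′)
                  λ v∈ → proj₂ (∈-filter⁻ (b #?_) {xs = B′} v∈))
                (clique-∷ (pairwise cliqueU x∈ y∈ x≢y ∷ []) (clique-∷ [] clique-[]))
                (λ { v∈ (here refl) → proj₁ (B′~ (filter-⊆ (b #?_) B′ v∈))
                   ; v∈ (there (here refl)) → proj₂ (B′~ (filter-⊆ (b #?_) B′ v∈)) })
            , λ v∈ → [ B′⊆L ∘ filter-⊆ (b #?_) B′ , all⇒⊆ (U⊆L x∈ ∷ U⊆L y∈ ∷ []) ]′ (∈-++⁻ Z v∈)))
            where Z = filter (b #?_) B′

      -- `U` is a clique of common neighbours of `b` and `b′`, so it has at most two vertices, and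
      -- the cases are its three possible sizes.
      gap-in-B : ∀ {a b a′ b′} → (a , b) ∈ M → (a′ , b′) ∈ M → b # b′ →
        length M + length U ≤ suc ω
      gap-in-B {a} ab∈ ab∈′ b#b′ = go U refl
        (common-~-length b#b′ cliqueU λ x∈ → B~U (∈-map⁺ proj₂ ab∈) x∈ , B~U (∈-map⁺ proj₂ ab∈′) x∈)
        where
        L≤ : length M + length M + length U ≤ 2 + (ω + ω)
        L≤ = ≤-trans (≤-reflexive (≡-sym (length-L matching))) length≤2ω+2
        go : ∀ W → U ≡ W → length W ≤ 2 → length M + length W ≤ suc ω
        go [] refl _ = ≤-trans (≤-reflexive (+-identityʳ _)) (double-cancel-≤
          (≤-trans (≤-reflexive (≡-sym (+-identityʳ _)))
            (≤-trans L≤ (≤-reflexive (cong suc (≡-sym (+-suc ω ω)))))))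
        -- By parity, 2|M| + 1 ≤ 2ω + 2 yields |M| ≤ ω.
        go (_ ∷ []) refl _ = ≤-trans (≤-reflexive (+-comm _ 1)) (s≤s (double-cancel-≤-suc
          (s≤s⁻¹ (≤-trans (≤-reflexive (+-comm 1 _)) L≤))))
        go (x ∷ y ∷ []) refl _ = ≤-trans (≤-reflexive (+-comm _ 2)) (s≤s two)
          where
          x≢y : x ≢ y
          x≢y with unique cliqueU
          ... | (p ∷ _) ∷ _ = p
          open TwoUnmatched (here refl) (there (here refl)) x≢y ab∈ ab∈′ b#b′
          module Swapped = TwoUnmatched (there (here refl)) (here refl) (≢-sym x≢y) ab∈ ab∈′ b#b′
          two : suc (length M) ≤ ω
          -- Either every first end has a gap to `x` or `y`, where the roles of `x` and `y` are
          -- interchangeable, or some first end is adjacent to both.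
          two with All.all? (λ a → (a #? x) ⊎-dec (a #? y)) A
          ... | yes hit with All.lookup hit (∈-map⁺ proj₁ ab∈)
          ...   | inj₁ a#x = all-ends-hit (All.lookup hit) a#x
          ...   | inj₂ a#y = Swapped.all-ends-hit ([ inj₂ , inj₁ ]′ ∘ All.lookup hit) a#y
          two | no ¬hit with find (All.¬All⇒Any¬ (λ a → (a #? x) ⊎-dec (a #? y)) A ¬hit)
          ... | c , c∈ , ¬c = end-missed refl c∈
            (¬#⇒~ (A≢U c∈ (here refl)) (¬c ∘ inj₁)) (¬#⇒~ (A≢U c∈ (there (here refl))) (¬c ∘ inj₂))
        go (_ ∷ _ ∷ _ ∷ _) _ (s≤s (s≤s ()))

      -- If the bound failed, `gap-in-B` would exclude gaps inside `B`, making `B ++ U` a clique of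
      -- |M| + |U| vertices.
      matching-size : length M + length U ≤ suc ω
      matching-size = decidable-stable (_ ≤? _) λ ≰ → ≰ (≤-trans
        (≤-trans (≤-reflexive (≡-sym length-B++U)) (maximum
          ( clique-++ (record { unique = uB ; noGap = λ p q r → ≰ (gaps-B p q r) }) cliqueU B~U
          , λ v∈ → [ B⊆L , U⊆L ]′ (∈-++⁻ B v∈))))
        (m≤n+m ω 1))
        where
        gaps-B : ∀ {b b′} → b ∈ B → b′ ∈ B → b # b′ → length M + length U ≤ suc ω
        gaps-B b∈ b∈′ b#b′ with ∈-map⁻ proj₂ b∈ | ∈-map⁻ proj₂ b∈′
        ... | _ , ab∈ , refl | _ , ab∈′ , refl = gap-in-B ab∈ ab∈′ b#b′

    minimal-matching-size : ∀ {M U} → Matching M U →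
      (∀ {M′ U′} → Matching M′ U′ → length U ≤ length U′) → length M + length U ≤ suc ω
    minimal-matching-size {M} {U} matching minimal
      with MinimalMatching.orient matching minimal M
             (MinimalMatching.free-end matching minimal) (gaps matching)
    ... | N , N↭ , len , gapsN , free = subst (λ k → k + length U ≤ suc ω) len
      (OrientedMatching.matching-size
        (record { perm = ↭-trans (++⁺ʳ U N↭) (perm matching) ; gaps = gapsN }) minimal free)

  -- Colourings of lists of vertices

  record Colouring (xs : List V) (k : ℕ) : Set where
    field
      colour  : V → ℕ
      bounded : ∀ {v} → v ∈ xs → colour v < k
      proper  : ∀ {u v} → u ∈ xs → v ∈ xs → u ~ v → colour u ≢ colour v

  open Colouring

  colouring-[] : Colouring [] 0
  colouring-[] = record { colour = λ _ → 0 ; bounded = λ () ; proper = λ () }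

  colouring-⊆ : ∀ {xs ys k l} → xs ⊆ ys → k ≤ l → Colouring ys k → Colouring xs l
  colouring-⊆ xs⊆ys k≤l C = record
    { colour = colour C
    ; bounded = λ v∈ → ≤-trans (bounded C (xs⊆ys v∈)) k≤l
    ; proper = λ u∈ v∈ → proper C (xs⊆ys u∈) (xs⊆ys v∈)
    }

  independent-colouring : ∀ {xs} → (∀ {u v} → u ∈ xs → v ∈ xs → ¬ u ~ v) → Colouring xs 1
  independent-colouring h = record
    { colour = λ _ → 0 ; bounded = λ _ → s≤s z≤n ; proper = λ u∈ v∈ u~v → contradiction u~v (h u∈ v∈) }

  colouring-++ : ∀ {xs ys k l} → Colouring xs k → Colouring ys l → Colouring (xs ++ ys) (k + l)
  colouring-++ {xs} {ys} {k} {l} C D = record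
    { colour = joint ; bounded = joint-bounded ; proper = joint-proper }
    where
    joint : V → ℕ
    -- The lists may overlap; a vertex of both takes its colour from `C`.
    joint v with any? (v ≟_) xs
    ... | yes _ = colour C v
    ... | no _ = k + colour D v
    in-ys : ∀ {v} → v ∉ xs → v ∈ xs ++ ys → v ∈ ys
    in-ys v∉ v∈ = [ (λ p → contradiction p v∉) , id ]′ (∈-++⁻ xs v∈)
    joint-bounded : ∀ {v} → v ∈ xs ++ ys → joint v < k + l
    joint-bounded {v} v∈ with any? (v ≟_) xs
    ... | yes p = ≤-trans (bounded C p) (m≤m+n k l)
    ... | no p = ≤-trans (≤-reflexive (≡-sym (+-suc k _))) (+-monoʳ-≤ k (bounded D (in-ys p v∈)))
    joint-proper : ∀ {u v} → u ∈ xs ++ ys → v ∈ xs ++ ys → u ~ v → joint u ≢ joint v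
    joint-proper {u} {v} u∈ v∈ u~v with any? (u ≟_) xs | any? (v ≟_) xs
    ... | yes p | yes q = proper C p q u~v
    ... | yes p | no _ = λ eq → 1+n≰n (≤-trans (s≤s (m≤m+n k _)) (subst (_< k) eq (bounded C p)))
    ... | no _ | yes q = λ eq → 1+n≰n (≤-trans (s≤s (m≤m+n k _)) (subst (_< k) (≡-sym eq) (bounded C q)))
    ... | no p | no q = λ eq → proper D (in-ys p u∈) (in-ys q v∈) u~v (+-cancelˡ-≡ k _ _ eq)

  list-colouring : ∀ xs → Colouring xs (length xs)
  list-colouring [] = colouring-[]
  list-colouring (x ∷ xs) = colouring-++
    (independent-colouring {x ∷ []} λ { (here refl) (here refl) → ~-irrefl }) (list-colouring xs)

  matching-colouring : ∀ {M} U → All (λ (a , b) → a # b) M →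
    Colouring (pairUp M ++ U) (length M + length U)
  matching-colouring U [] = list-colouring U
  matching-colouring U (_∷_ {a , b} a#b gaps) = colouring-++
    (independent-colouring {a ∷ b ∷ []} λ where
      (here refl) (here refl) → ~-irrefl
      (here refl) (there (here refl)) p → ~⇒¬# p a#b
      (there (here refl)) (here refl) p → ~⇒¬# p (#-sym a#b)
      (there (here refl)) (there (here refl)) → ~-irrefl)
    (matching-colouring U gaps)

  -- Greedy colouring of disjoint unions of cliques

  module _ {xs k} (C : Colouring xs k) (v : V) where

    recolour : ℕ → V → ℕ
    recolour i w with w ≟ v
    ... | yes _ = i
    ... | no _ = colour C w

    recoloured : ∀ {i l} → i < l → k ≤ l → (∀ {w} → w ∈ xs → v ~ w → colour C w ≢ i) →
      Colouring (v ∷ xs) l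
    recoloured {i} {l} i<l k≤l missing = record
      { colour = recolour i ; bounded = bounded′ ; proper = proper′ }
      where
      tail∈ : ∀ {w} → w ≢ v → w ∈ v ∷ xs → w ∈ xs
      tail∈ w≢v (here p) = contradiction p w≢v
      tail∈ _ (there p) = p
      bounded′ : ∀ {w} → w ∈ v ∷ xs → recolour i w < l
      bounded′ {w} w∈ with w ≟ v
      ... | yes _ = i<l
      ... | no w≢v = ≤-trans (bounded C (tail∈ w≢v w∈)) k≤l
      proper′ : ∀ {u w} → u ∈ v ∷ xs → w ∈ v ∷ xs → u ~ w → recolour i u ≢ recolour i w
      proper′ {u} {w} u∈ w∈ u~w with u ≟ v | w ≟ v
      ... | yes refl | yes refl = contradiction u~w ~-irrefl
      ... | yes refl | no w≢v = missing (tail∈ w≢v w∈) u~w ∘ ≡-sym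
      ... | no u≢v | yes refl = missing (tail∈ u≢v u∈) (~-sym u~w)
      ... | no u≢v | no w≢v = proper C (tail∈ u≢v u∈) (tail∈ w≢v w∈) u~w

    -- If each colour below `j` occurs at a neighbour of `v`, one neighbour per colour is chosen.
    -- They form a clique, since there is no gap between neighbours of `v`.
    missing-or-rainbow : (∀ {x y} → x ∈ xs → y ∈ xs → v ~ x → v ~ y → ¬ x # y) → ∀ j →
      (∃ λ i → i < j × (∀ {w} → w ∈ xs → v ~ w → colour C w ≢ i)) ⊎
      (∃ λ Q → Clique Q × length Q ≡ j × (∀ {w} → w ∈ Q → w ∈ xs × v ~ w × colour C w < j))
    missing-or-rainbow _ zero = inj₂ ([] , clique-[] , refl , λ ())
    missing-or-rainbow h (suc j) with missing-or-rainbow h j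
    ... | inj₁ (i , i<j , p) = inj₁ (i , m≤n⇒m≤1+n i<j , p)
    ... | inj₂ (Q , cQ , len , inQ) with any? (λ w → (v ~? w) ×-dec (colour C w Nat.≟ j)) xs
    ...   | no none = inj₁ (j , ≤-refl , λ w∈ v~w eq → none (lose w∈ (v~w , eq)))
    ...   | yes some with find some
    ...     | w , w∈ , v~w , refl =
      inj₂ ( w ∷ Q , clique-∷ (All.tabulate w~) cQ , cong suc len
           , λ { (here refl) → w∈ , v~w , ≤-refl
               ; (there u∈) → let u∈xs , v~u , lt = inQ u∈ in u∈xs , v~u , m≤n⇒m≤1+n lt })
      where
      w~ : ∀ {u} → u ∈ Q → w ~ u
      -- The vertices differ because `u` has a colour below `j` while `w` has colour `j`.
      w~ u∈ = let u∈xs , v~u , lt = inQ u∈ in ¬#⇒~ (λ { refl → 1+n≰n lt }) (h w∈ u∈xs v~w v~u)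

  -- The neighbours of `v` span no gap, as `v` would be the middle of an induced path. Either `v`
  -- reuses a colour missing among them, or a rainbow clique of neighbours grows by `v`, which pays
  -- for a fresh colour.
  P3-free-colouring : ∀ xs →
    (∀ {p q r} → p ∈ xs → q ∈ xs → r ∈ xs → p ~ q → q ~ r → ¬ p # r) →
    ∃ λ Q → Clique Q × Q ⊆ xs × Colouring xs (length Q)
  P3-free-colouring [] _ = [] , clique-[] , id , colouring-[]
  P3-free-colouring (v ∷ xs) P3-free
    with P3-free-colouring xs (λ p∈ q∈ r∈ → P3-free (there p∈) (there q∈) (there r∈))
  ... | Q , cQ , Q⊆ , C with missing-or-rainbow C v
                               (λ x∈ y∈ v~x v~y → P3-free (there x∈) (here refl) (there y∈) (~-sym v~x) v~y)
                               (length Q)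
  ...   | inj₁ (i , i<k , missing) = Q , cQ , there ∘ Q⊆ , recoloured C v i<k ≤-refl missing
  ...   | inj₂ (N , cN , len , inN) =
    v ∷ N , clique-∷ (All.tabulate (proj₁ ∘ proj₂ ∘ inN)) cN ,
    (λ { (here refl) → here refl ; (there w∈) → there (proj₁ (inN w∈)) }) ,
    recoloured C v (s≤s (≤-reflexive (≡-sym len))) (≤-trans (≤-reflexive (≡-sym len)) (m≤n+m _ 1))
      (λ w∈ _ eq → 1+n≰n (≤-trans (bounded C w∈) (≤-reflexive (≡-sym eq))))

  -- By Olariu's theorem the complement of G, being paw-free, has only triangle-free and complete
  -- multipartite components. This is the component of a triangle of the complement.
  module IndependentTriple (P3∪K1-free : P3∪K1Free) where

    -- Otherwise the path b v c and `a` induce P₃ ∪ K₁.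
    second-gap : ∀ {a b c v} → a # b → b # c → a # c → v # a → v # b ⊎ v # c
    second-gap {a} {b} {c} {v} a#b b#c a#c v#a with position v b | position v c
    ... | gap p | _ = inj₁ p
    ... | _ | gap p = inj₂ p
    ... | equal refl | _ = inj₂ b#c
    ... | _ | equal refl = inj₁ (#-sym b#c)
    ... | adjacent p | adjacent q =
      ⊥-elim (P3∪K1-free (~-sym p) q b#c a#b (#-sym v#a) a#c)

    Near : V → V → V → V → Set
    Near a b c v = v # a ⊎ v # b ⊎ v # c

    -- If `p` were adjacent to `a`, then by `second-gap` it would have gaps to both `b` and `c`,
    -- while `q` has a gap to one of these. That vertex and the path a p q would induce P₃ ∪ K₁.
    gap-transfer : ∀ {a b c p q} → a # b → b # c → a # c → Near a b c p → p ~ q → q # a → p # a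
    gap-transfer {a} {b} {c} {p} {q} a#b b#c a#c near p~q q#a with position p a
    ... | gap p#a = p#a
    ... | equal refl = contradiction (#-sym q#a) (~⇒¬# p~q)
    ... | adjacent p~a = ⊥-elim (third (both near) (second-gap a#b b#c a#c q#a))
      where
      not-a : ¬ p # a
      not-a = ~⇒¬# p~a
      both : Near a b c p → p # b × p # c
      both (inj₁ p#a) = contradiction p#a not-a
      both (inj₂ (inj₁ p#b)) =
        p#b , [ id , (λ p#a → contradiction p#a not-a) ]′ (second-gap b#c (#-sym a#c) (#-sym a#b) p#b)
      both (inj₂ (inj₂ p#c)) =
        [ (λ p#a → contradiction p#a not-a) , id ]′ (second-gap (#-sym a#c) a#b (#-sym b#c) p#c) , p#c
      third : p # b × p # c → ¬ (q # b ⊎ q # c)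
      third (p#b , _) (inj₁ q#b) =
        P3∪K1-free (~-sym p~a) p~q (#-sym q#a) (#-sym a#b) (#-sym p#b) (#-sym q#b)
      third (_ , p#c) (inj₂ q#c) =
        P3∪K1-free (~-sym p~a) p~q (#-sym q#a) (#-sym a#c) (#-sym p#c) (#-sym q#c)

    module _ {a b c} (a#b : a # b) (b#c : b # c) (a#c : a # c) where

      -- A vertex of the triple with a gap to `q` has, by `gap-transfer`, gaps to `p` and `r` too,
      -- so it is the isolated vertex beside the path p q r.
      near-P3-free : ∀ {p q r} → Near a b c p → Near a b c q → Near a b c r →
        p ~ q → q ~ r → ¬ p # r
      near-P3-free {p} {q} {r} np nq nr p~q q~r p#r with nq
      ... | inj₁ q#a = P3∪K1-free p~q q~r p#r
        (#-sym (gap-transfer a#b b#c a#c np p~q q#a)) (#-sym q#a)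
        (#-sym (gap-transfer a#b b#c a#c nr (~-sym q~r) q#a))
      ... | inj₂ (inj₁ q#b) = P3∪K1-free p~q q~r p#r
        (#-sym (gap-transfer b#c (#-sym a#c) (#-sym a#b) (rotate np) p~q q#b)) (#-sym q#b)
        (#-sym (gap-transfer b#c (#-sym a#c) (#-sym a#b) (rotate nr) (~-sym q~r) q#b))
        where
        rotate : ∀ {v} → Near a b c v → Near b c a v
        rotate = [ inj₂ ∘ inj₂ , [ inj₁ , inj₂ ∘ inj₁ ]′ ]′
      ... | inj₂ (inj₂ q#c) = P3∪K1-free p~q q~r p#r
        (#-sym (gap-transfer (#-sym a#c) a#b (#-sym b#c) (rotate np) p~q q#c)) (#-sym q#c)
        (#-sym (gap-transfer (#-sym a#c) a#b (#-sym b#c) (rotate nr) (~-sym q~r) q#c))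
        where
        rotate : ∀ {v} → Near a b c v → Near c a b v
        rotate = [ inj₂ ∘ inj₁ , [ inj₂ ∘ inj₂ , inj₁ ]′ ]′

      -- `w` is adjacent to the whole triple, and `d` has gaps to two of its members. Were `d # w`,
      -- these two with `w` between them would be a path with `d` isolated from it.
      near-join : ∀ {d w} → Near a b c d → ¬ Near a b c w → d ~ w
      near-join {d} {w} nd ¬nw = ¬#⇒~ (λ { refl → ¬nw nd }) λ d#w →
        [ (λ d#a → [ cross a#b w~a w~b d#w d#a , cross a#c w~a w~c d#w d#a ]′
                     (second-gap a#b b#c a#c d#a))
        , [ (λ d#b → [ cross b#c w~b w~c d#w d#b , cross (#-sym a#b) w~b w~a d#w d#b ]′
                       (second-gap b#c (#-sym a#c) (#-sym a#b) d#b))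
          , (λ d#c → [ cross (#-sym a#c) w~c w~a d#w d#c , cross (#-sym b#c) w~c w~b d#w d#c ]′
                       (second-gap (#-sym a#c) a#b (#-sym b#c) d#c)) ]′ ]′ nd
        where
        w~a : w ~ a
        w~a = ¬#⇒~ (λ { refl → ¬nw (inj₂ (inj₁ a#b)) }) (¬nw ∘ inj₁)
        w~b : w ~ b
        w~b = ¬#⇒~ (λ { refl → ¬nw (inj₂ (inj₂ b#c)) }) (¬nw ∘ inj₂ ∘ inj₁)
        w~c : w ~ c
        w~c = ¬#⇒~ (λ { refl → ¬nw (inj₁ (#-sym a#c)) }) (¬nw ∘ inj₂ ∘ inj₂)
        cross : ∀ {x y} → x # y → w ~ x → w ~ y → d # w → d # x → ¬ d # y
        cross x#y w~x w~y d#w d#x d#y = P3∪K1-free (~-sym w~x) w~y x#y d#x d#w d#y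

  -- Induction on the number of vertices

  NearlyPerfect : List V → Set
  -- `Q` stands in for the clique number, of which it is a lower bound.
  NearlyPerfect L = ∃ λ Q → Clique Q × Q ⊆ L × Colouring L (suc (length Q))

  module _ (K5-e-free : K5-eFree) (P3∪K1-free : P3∪K1Free) where

    dense⇒nearlyPerfect : ∀ {L} → Unique L →
      (∀ {u v w} → u ∈ L → v ∈ L → w ∈ L → u # v → v # w → u # w → ⊥) → ¬ ¬ NearlyPerfect L
    dense⇒nearlyPerfect {L} uL α≤2 ¬goal =
      ¬¬-∃-maximal {P = λ Q → Clique Q × Q ⊆ L} length (length L)
        (λ (c , Q⊆) → unique-⊆-length (unique c) Q⊆) (clique-[] , λ ())
        λ (I , (cI , I⊆L) , maximum) → colour-by-matching cI I⊆L maximum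
      where
      colour-by-matching : ∀ {I} → Clique I → (I⊆L : I ⊆ L) →
        (∀ {Q} → Clique Q × Q ⊆ L → length Q ≤ length I) → ⊥
      colour-by-matching {I} cI I⊆L maximum =
        ¬¬-∃-maximal {P = λ (M , U) → Matching M U} (length ∘ proj₁) (length L)
          (λ {(M , U)} m → ≤-trans (m≤m+n (length M) _)
            (≤-trans (m≤m+n (length M + length M) (length U)) (≤-reflexive (≡-sym (length-L m)))))
          {[] , L} (record { perm = ↭-refl ; gaps = [] })
          λ ((M , U) , m , max-m) → ¬goal (I , cI , I⊆L ,
            colouring-⊆ (∈-resp-↭ (↭-sym (Matching.perm m)))
              -- As `length L` is twice the number of pairs plus the number of unmatched vertices, a
              -- matching with most pairs leaves fewest unmatched.
              (minimal-matching-size m λ {M′} {U′} m′ → +-cancelˡ-≤ (length M′ + length M′) _ _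
                (≤-trans (+-monoˡ-≤ (length U) (+-mono-≤ (max-m m′) (max-m m′)))
                  (≤-reflexive (trans (≡-sym (length-L m)) (length-L m′)))))
              (matching-colouring U (Matching.gaps m)))
        where open Dense K5-e-free uL α≤2 cI I⊆L maximum

    nearlyPerfect : ∀ fuel {L} → Unique L → length L < fuel → ¬ ¬ NearlyPerfect L
    nearlyPerfect (suc fuel) {L} uL (s≤s L≤fuel) ¬goal =
      -- No search for an independent triple is made: under the assumption `¬goal`, any such triple
      -- is refuted by `split`, so the dense case applies.
      dense⇒nearlyPerfect uL
        (λ a∈ _ _ a#b b#c a#c → split a∈ a#b b#c a#c) ¬goal
      where
      open IndependentTriple P3∪K1-free
      split : ∀ {a b c} → a ∈ L → a # b → b # c → a # c → ⊥
      split {a} {b} {c} a∈ a#b b#c a#c =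
        nearlyPerfect fuel (Unique.filter⁺ far? uL)
          -- `a` is near because of `a # b`, so the far part is strictly shorter than `L`.
          (≤-trans (filter-notAll far? L (lose a∈ (λ ¬near → ¬near (inj₂ (inj₁ a#b))))) L≤fuel)
          λ (R , cR , R⊆ , C) → ¬goal
            ( Q ++ R
            , clique-++ cQ cR (λ d∈ w∈ → near-join a#b b#c a#c
                (proj₂ (near⁻ (Q⊆ d∈))) (proj₂ (far⁻ (R⊆ w∈))))
            , (λ v∈ → [ filter-⊆ near? L ∘ Q⊆ , filter-⊆ far? L ∘ R⊆ ]′ (∈-++⁻ Q v∈))
            , colouring-⊆ cover
                -- The near part uses just `length Q` colours; the one extra colour comes from the
                -- far part.
                (≤-reflexive (trans (+-suc (length Q) (length R)) (cong suc (≡-sym (length-++ Q)))))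
                (colouring-++ (proj₂ (proj₂ (proj₂ near-coloured))) C))
        where
        near? : ∀ v → Dec (Near a b c v)
        near? v = (v #? a) ⊎-dec ((v #? b) ⊎-dec (v #? c))
        far? : ∀ v → Dec (¬ Near a b c v)
        far? v = ¬? (near? v)
        near⁻ : ∀ {v} → v ∈ filter near? L → v ∈ L × Near a b c v
        near⁻ = ∈-filter⁻ near?
        far⁻ : ∀ {v} → v ∈ filter far? L → v ∈ L × ¬ Near a b c v
        far⁻ = ∈-filter⁻ far?
        near-coloured = P3-free-colouring (filter near? L) λ p∈ q∈ r∈ →
          near-P3-free a#b b#c a#c (proj₂ (near⁻ p∈)) (proj₂ (near⁻ q∈)) (proj₂ (near⁻ r∈))
        Q = proj₁ near-coloured
        cQ = proj₁ (proj₂ near-coloured)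
        Q⊆ = proj₁ (proj₂ (proj₂ near-coloured))
        cover : L ⊆ filter near? L ++ filter far? L
        cover {v} v∈ with near? v
        ... | yes p = ∈-++⁺ˡ (∈-filter⁺ near? v∈ p)
        ... | no p = ∈-++⁺ʳ (filter near? L) (∈-filter⁺ far? v∈ p)

-- Translation to induced subgraphs, clique number and chromatic number

allPairs-∈ : ∀ {A : Set} {R : A → A → Set} → (∀ {x y} → R x y → R y x) →
  ∀ {xs} → AllPairs R xs → ∀ {x y} → x ∈ xs → y ∈ xs → x ≢ y → R x y
allPairs-∈ _ (_ ∷ _) (here refl) (here refl) x≢y = contradiction refl x≢y
allPairs-∈ _ (r ∷ _) (here refl) (there y∈) _ = All.lookup r y∈
allPairs-∈ R-sym (r ∷ _) (there x∈) (here refl) _ = R-sym (All.lookup r x∈)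
allPairs-∈ R-sym (_ ∷ rs) (there x∈) (there y∈) x≢y = allPairs-∈ R-sym rs x∈ y∈ x≢y

-- Each unordered pair of vertices is checked once; symmetry and irreflexivity supply the remaining
-- entries.
inducedSub : ∀ {m n} {H : Graph m} {G : Graph n} (f : Fin m → Fin n) →
  AllPairs (λ i j → f i ≢ f j × adj G (f i) (f j) ≡ adj H i j) (allFin m) → InducedSub H G
inducedSub {H = H} {G} f pairs = f , injective , adjacency
  where
  entry : ∀ {i j} → i ≢ j → f i ≢ f j × adj G (f i) (f j) ≡ adj H i j
  entry {i} {j} = allPairs-∈
    (λ {i} {j} (p , q) → ≢-sym p , trans (Graph.sym G (f j) (f i)) (trans q (Graph.sym H i j)))
    pairs (∈-allFin i) (∈-allFin j)
  injective : ∀ {i j} → f i ≡ f j → i ≡ j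
  injective {i} {j} eq = decidable-stable (i ≟ j) λ i≢j → proj₁ (entry i≢j) eq
  adjacency : ∀ i j → adj G (f i) (f j) ≡ adj H i j
  adjacency i j with i ≟ j
  ... | yes refl = trans (irrefl G (f i)) (≡-sym (irrefl H i))
  ... | no i≢j = proj₂ (entry i≢j)

module _ {n} (G : Graph n) where
  open Complement G

  K5-eFree⁺ : Free K5-e G → K5-eFree
  K5-eFree⁺ free u#v x~y x~z y~z u~x u~y u~z v~x v~y v~z = free (inducedSub {H = K5-e} {G}
    (lookup (_ ∷ _ ∷ _ ∷ _ ∷ _ ∷ []))
    ( (u#v ∷ edge u~x ∷ edge u~y ∷ edge u~z ∷ [])
    ∷ (edge v~x ∷ edge v~y ∷ edge v~z ∷ [])
    ∷ (edge x~y ∷ edge x~z ∷ [])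
    ∷ (edge y~z ∷ []) ∷ [] ∷ []))
    where
    edge : ∀ {u v} → u ~ v → u ≢ v × adj G u v ≡ true
    edge p = ~⇒≢ p , p

  P3∪K1Free⁺ : Free P3∪K1 G → P3∪K1Free
  P3∪K1Free⁺ free p~q q~r p#r s#p s#q s#r = free (inducedSub {H = P3∪K1} {G}
    (lookup (_ ∷ _ ∷ _ ∷ _ ∷ []))
    ( ((~⇒≢ p~q , p~q) ∷ p#r ∷ #-sym s#p ∷ [])
    ∷ ((~⇒≢ q~r , q~r) ∷ #-sym s#q ∷ [])
    ∷ (#-sym s#r ∷ []) ∷ [] ∷ []))

  hasClique : ∀ {Q} → Clique Q → HasClique G (length Q)
  hasClique {Q} cQ = lookup Q , inj , λ i j i≢j →
    pairwise cQ (∈-lookup i) (∈-lookup j) (i≢j ∘ inj)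
    where
    inj : ∀ {i j} → lookup Q i ≡ lookup Q j → i ≡ j
    inj = lookup-injective (unique cQ)

  colourable : ∀ {k} → Colouring (allFin n) k → Colourable G k
  colourable C = (λ v → fromℕ< (bounded C (∈-allFin v))) , λ u v u~v eq →
    proper C (∈-allFin u) (∈-allFin v) u~v
      (trans (≡-sym (toℕ-fromℕ< _)) (trans (cong toℕ eq) (toℕ-fromℕ< _)))
    where open Colouring

theorem3 : ∀ {n} (G : Graph n) (ω χ : ℕ) →
    Free K5-e G → Free P3∪K1 G →
    IsCliqueNumber G ω → IsChromaticNumber G χ →
    χ ≤ ω + 1
theorem3 {n} G ω χ K5-e-free P3∪K1-free (_ , ω-max) (_ , χ-min) =
  -- The inequality is decidable, which discharges the double negation carried by `nearlyPerfect`.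
  decidable-stable (χ ≤? ω + 1) λ χ≰ →
    Complement.nearlyPerfect G (K5-eFree⁺ G K5-e-free) (P3∪K1Free⁺ G P3∪K1-free)
      (suc (length (allFin n))) (Unique.allFin⁺ n) ≤-refl
      λ (Q , cQ , _ , C) → χ≰ (≤-trans (χ-min _ (colourable G C))
        (≤-trans (s≤s (ω-max _ (hasClique G cQ))) (≤-reflexive (+-comm 1 ω))))
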